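{- Let $\mathbb F_2$ be the free group with free generators $a,b$. Let $\alpha,\beta:\mathbb Z\to\mathbb Z$ be bounded odd functions such that $\alpha(n)\neq0$ for all but finitely many $n\in\mathbb Z$, and let $f:\mathbb F_2\to\mathbb Z$ be given by $$f(a^{n_1}b^{m_1}\cdots a^{n_k}b^{m_k}):=\sum_{i=1}^k\bigl(\alpha(n_i)+\beta(m_i)\bigr),$$ where $n_i\neq0$ for $1<i\leq k$ and $m_i\neq0$ for $1\leq i<k$. Let $M$ be the two-sorted structure with sorts the groups $(\mathbb F_2,\cdot)$ and $(\mathbb Z,+)$ together with the function $f$ (or any expansion of this structure), let $M^*\succ M$ be a monster model with corresponding sorts $\mathbb F_2^*,\mathbb Z^*$ and function $f^*:\mathbb F_2^*\to\mathbb Z^*$, let $X\subseteq\mathbb F_2^*\times\mathbb Z^*$ be the graph of $f^*$ (which is a $\emptyset$-definable approximate subgroup), and let $H:=\langle X\rangle$ be the subgroup of $\mathbb F_2^*\times\mathbb Z^*$ generated by $X$. Then for every $m\geq1$, $H^{000}_\emptyset$ is not contained in $X^m$.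
   Context: A monster model is $\kappa$-saturated and strongly $\kappa$-homogeneous for a sufficiently large cardinal $\kappa$; bounded means of cardinality $<\kappa$. An approximate subgroup of a group is a symmetric subset $X$ such that $X^2=XX$ is contained in finitely many left translates of $X$. $X^m$ denotes the $m$-fold product set. $H^{000}_\emptyset$ is the smallest $\mathrm{Aut}(M^*)$-invariant subgroup of $H$ of bounded index in $H$ (it always exists). -}

module Defs where

open import Level using (Level; 0ℓ; _⊔_; Lift) renaming (suc to lsuc)
open import Algebra.Bundles using (Group)
open import Algebra.Construct.DirectProduct using () renaming (group to _×ᴳ_)
open import Algebra.Definitions.RawMonoid using (sum) renaming (_×_ to power)
open import Data.Bool.Base using (Bool; true; false; not)
open import Data.Bool.Properties using (not-involutive) renaming (_≟_ to _≟ᵇ_)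
open import Data.Empty using (⊥; ⊥-elim)
open import Data.Fin.Base using (Fin; suc; inject₁)
open import Data.Integer.Base as ℤ using (ℤ; +_; -[1+_]; ∣_∣)
open import Data.Integer.Properties using (+-0-isGroup)
open import Data.List.Base using (List; []; _∷_; [_]; _++_; foldr; map; reverse)
open import Data.List.Properties using (foldr-++; unfold-reverse)
open import Data.List.Membership.Propositional using (_∈_; _∉_)
open import Data.List.Relation.Unary.All as All using (All; []; _∷_)
open import Data.List.Relation.Unary.Any using (here; there)
open import Data.List.Relation.Unary.Linked using (Linked; []; [-]; _∷_; linked?)
open import Data.Nat.Base using (ℕ; zero; suc; _≤_)
open import Data.Product.Base using (Σ; Σ-syntax; ∃; ∃-syntax; _×_; _,_; proj₁; proj₂)
open import Data.Product.Properties using (≡-dec)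
open import Data.Sum.Base using (_⊎_; inj₁; inj₂; [_,_]′)
open import Function.Bundles using (_⇔_; _↣_; Equivalence)
open import Function.Definitions using (Bijective)
open import Relation.Binary.Definitions using (DecidableEquality)
open import Relation.Binary.PropositionalEquality
  using (_≡_; _≢_; refl; sym; trans; cong; cong₂; subst; isEquivalence)
open import Relation.Nullary using (¬_; yes; no; ¬?)
open import Relation.Nullary.Decidable using (recompute)
open import Relation.Unary using (Pred; _⊆_)

private variable
  a b c c′ ℓ ℓ′ : Level

data Gen : Set where
  ga gb : Gen

_≟ᵍ_ : DecidableEquality Gen
ga ≟ᵍ ga = yes refl
ga ≟ᵍ gb = no λ ()
gb ≟ᵍ ga = no λ ()
gb ≟ᵍ gb = yes refl

-- (x , true) is the generator x and (x , false) its inverse.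
Letter : Set
Letter = Gen × Bool

opp : Letter → Letter
opp (x , s) = x , not s

opp-involutive : ∀ x → opp (opp x) ≡ x
opp-involutive (x , s) = cong (x ,_) (not-involutive s)

_≟ˡ_ : DecidableEquality Letter
_≟ˡ_ = ≡-dec _≟ᵍ_ _≟ᵇ_

Reduced : List Letter → Set
Reduced = Linked λ x y → y ≢ opp x

-- The free group on ga, gb as the set of reduced words.  The reducedness proof
-- is irrelevant, so that _≡_ on F₂ is equality of
-- the underlying words.
record F₂ : Set where
  constructor mk
  field
    word     : List Letter
    .reduced : Reduced word
open F₂ public

reduced′ : (g : F₂) → Reduced (word g)
reduced′ (mk w r) = recompute (linked? (λ x y → ¬? (y ≟ˡ opp x)) w) r

F₂-≡ : {g h : F₂} → word g ≡ word h → g ≡ h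
F₂-≡ {mk _ _} {mk _ _} refl = refl

infixr 5 _◁_

_◁_ : Letter → List Letter → List Letter
x ◁ [] = x ∷ []
x ◁ (y ∷ w) with y ≟ˡ opp x
... | yes _ = w
... | no  _ = x ∷ y ∷ w

_◁*_ : List Letter → List Letter → List Letter
u ◁* v = foldr _◁_ v u

◁-reduced : ∀ x {w} → Reduced w → Reduced (x ◁ w)
◁-reduced x [] = [-]
◁-reduced x {y ∷ _} r with y ≟ˡ opp x
◁-reduced x [-]     | yes _ = []
◁-reduced x (_ ∷ r) | yes _ = r
◁-reduced x r       | no  n = n ∷ r

◁*-reduced : ∀ u {v} → Reduced v → Reduced (u ◁* v)
◁*-reduced []      r = r
◁*-reduced (x ∷ u) r = ◁-reduced x (◁*-reduced u r)

◁-cancelˡ : ∀ x {w} → Reduced w → opp x ◁ (x ◁ w) ≡ w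
◁-cancelˡ x [] with x ≟ˡ opp (opp x)
... | yes _ = refl
... | no  n = ⊥-elim (n (sym (opp-involutive x)))
◁-cancelˡ x {y ∷ w} r with y ≟ˡ opp x
◁-cancelˡ x [-] | yes refl = refl
◁-cancelˡ x {_ ∷ z ∷ _} (n ∷ _) | yes refl with z ≟ˡ opp (opp x)
... | yes p = ⊥-elim (n p)
... | no  _ = refl
◁-cancelˡ x r | no _ with x ≟ˡ opp (opp x)
... | yes _ = refl
... | no  n = ⊥-elim (n (sym (opp-involutive x)))

◁-cancelʳ : ∀ x {w} → Reduced w → x ◁ (opp x ◁ w) ≡ w
◁-cancelʳ x {w} r =
  subst (λ y → y ◁ (opp x ◁ w) ≡ w) (opp-involutive x) (◁-cancelˡ (opp x) r)

◁-◁* : ∀ x u {v} → Reduced v → (x ◁ u) ◁* v ≡ x ◁ (u ◁* v)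
◁-◁* x [] r = refl
◁-◁* x (y ∷ u) r with y ≟ˡ opp x
... | yes refl = sym (◁-cancelʳ x (◁*-reduced u r))
... | no  _    = refl

◁*-assoc : ∀ u v {w} → Reduced w → (u ◁* v) ◁* w ≡ u ◁* (v ◁* w)
◁*-assoc []      v r = refl
◁*-assoc (x ∷ u) v r =
  trans (◁-◁* x (u ◁* v) r) (cong (x ◁_) (◁*-assoc u v r))

◁*-identityʳ : ∀ {w} → Reduced w → w ◁* [] ≡ w
◁*-identityʳ [] = refl
◁*-identityʳ [-] = refl
◁*-identityʳ {x ∷ y ∷ w} (n ∷ r) rewrite ◁*-identityʳ r with y ≟ˡ opp x
... | yes p = ⊥-elim (n p)
... | no  _ = refl

formalInverse : List Letter → List Letter
formalInverse w = reverse (map opp w)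

formalInverse-∷ : ∀ x u v →
  formalInverse (x ∷ u) ◁* v ≡ formalInverse u ◁* (opp x ◁ v)
formalInverse-∷ x u v = trans
  (cong (_◁* v) (unfold-reverse (opp x) (map opp u)))
  (foldr-++ _◁_ v (formalInverse u) [ opp x ])

formalInverse-cancelˡ : ∀ u {v} → Reduced v → formalInverse u ◁* (u ◁* v) ≡ v
formalInverse-cancelˡ []      r = refl
formalInverse-cancelˡ (x ∷ u) {v} r = trans (formalInverse-∷ x u _)
  (trans (cong (formalInverse u ◁*_) (◁-cancelˡ x (◁*-reduced u r)))
         (formalInverse-cancelˡ u r))

formalInverse-cancelʳ : ∀ u {v} → Reduced v → u ◁* (formalInverse u ◁* v) ≡ v
formalInverse-cancelʳ []      r = refl
formalInverse-cancelʳ (x ∷ u) {v} r = trans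
  (cong (λ w → x ◁ (u ◁* w)) (formalInverse-∷ x u v))
  (trans (cong (x ◁_) (formalInverse-cancelʳ u (◁-reduced (opp x) r)))
         (◁-cancelʳ x r))

_·_ : F₂ → F₂ → F₂
mk u r · mk v s = mk (u ◁* v) (◁*-reduced u s)

1F : F₂
1F = mk [] []

_⁻¹F : F₂ → F₂
mk u r ⁻¹F = mk (formalInverse u ◁* []) (◁*-reduced (formalInverse u) [])

F₂-group : Group 0ℓ 0ℓ
F₂-group = record
  { Carrier = F₂ ; _≈_ = _≡_ ; _∙_ = _·_ ; ε = 1F ; _⁻¹ = _⁻¹F
  ; isGroup = record
    { isMonoid = record
      { isSemigroup = record
        { isMagma = record { isEquivalence = isEquivalence ; ∙-cong = cong₂ _·_ }
        ; assoc = λ g h k → F₂-≡ (◁*-assoc (word g) (word h) (reduced′ k))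
        }
      ; identity = (λ g → refl) , λ g → F₂-≡ (◁*-identityʳ (reduced′ g))
      }
    ; inverse =
        (λ g → F₂-≡ (trans (◁*-assoc (formalInverse (word g)) [] (reduced′ g))
          (trans (cong (formalInverse (word g) ◁*_) (sym (◁*-identityʳ (reduced′ g))))
                 (formalInverse-cancelˡ (word g) []))))
      , (λ g → F₂-≡ (formalInverse-cancelʳ (word g) []))
    ; ⁻¹-cong = cong _⁻¹F
    }
  }

a₁ b₁ : F₂
a₁ = mk [ ga , true ] [-]
b₁ = mk [ gb , true ] [-]

infixr 8 _^ᶻ_

_^ᶻ_ : F₂ → ℤ → F₂
g ^ᶻ (+ n)    = power (Group.rawMonoid F₂-group) n g
g ^ᶻ -[1+ n ] = power (Group.rawMonoid F₂-group) (suc n) g ⁻¹F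

Bounded Odd AlmostNonzero : (ℤ → ℤ) → Set
Bounded α       = ∃[ B ] ∀ n → ∣ α n ∣ ≤ B
Odd α           = ∀ n → α (ℤ.- n) ≡ ℤ.- α n
AlmostNonzero α = ∃[ exceptions ] ∀ n → n ∉ exceptions → α n ≢ (+ 0)

ℤ-group : Group 0ℓ 0ℓ
ℤ-group = record { isGroup = +-0-isGroup }

-- sum over the monoid F₂ is the product in the order of the indices.  With
-- indices 0, …, k, the side conditions say that only the first exponent of a
-- and the last exponent of b may vanish; every element of F₂ is then written
-- in exactly one way, so this determines f.
GivenBy : (α β : ℤ → ℤ) → (F₂ → ℤ) → Set
GivenBy α β f = ∀ k (n m : Fin (suc k) → ℤ) →
  (∀ (i : Fin k) → n (suc i) ≢ (+ 0)) →
  (∀ (i : Fin k) → m (inject₁ i) ≢ (+ 0)) →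
  f (sum (Group.rawMonoid F₂-group) λ i → (a₁ ^ᶻ n i) · (b₁ ^ᶻ m i))
    ≡ sum (Group.rawMonoid ℤ-group) λ i → α (n i) ℤ.+ β (m i)

record Language (S : Set) (a : Level) : Set (lsuc a) where
  field
    Fun : List S → S → Set a
    Rel : List S → Set a
open Language public

_⊕_ : {S : Set} → Language S a → Language S b → Language S (a ⊔ b)
L ⊕ L′ = record
  { Fun = λ as s → Fun L as s ⊎ Fun L′ as s
  ; Rel = λ as → Rel L as ⊎ Rel L′ as
  }

record Interpretation {S : Set} (L : Language S a) (A : S → Set c) : Set (a ⊔ lsuc c) where
  field
    fun : ∀ {as s} → Fun L as s → All A as → A s
    rel : ∀ {as} → Rel L as → All A as → Set c
open Interpretation public

_⊕ᴵ_ : {S : Set} {L : Language S a} {L′ : Language S b} {A : S → Set c} →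
       Interpretation L A → Interpretation L′ A → Interpretation (L ⊕ L′) A
I ⊕ᴵ J = record { fun = [ fun I , fun J ]′ ; rel = [ rel I , rel J ]′ }

record Structure {S : Set} (L : Language S a) (c : Level) : Set (a ⊔ lsuc c) where
  constructor structure
  field
    Carrier : S → Set c
    interp  : Interpretation L Carrier
open Structure public

-- A context lists the sorts of the free variables.
data Term {S : Set} (L : Language S a) (Γ : List S) : S → Set a where
  var : ∀ {s} → s ∈ Γ → Term L Γ s
  app : ∀ {as s} → Fun L as s → All (Term L Γ) as → Term L Γ s

infix  7 _≐_
infixr 6 _∧′_
infixr 5 _∨′_
infixr 4 _⇒′_
infixr 3 ∀′_ ∃′_

data Formula {S : Set} (L : Language S a) (Γ : List S) : Set a where
  _≐_            : ∀ {s} → Term L Γ s → Term L Γ s → Formula L Γ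
  atom           : ∀ {as} → Rel L as → All (Term L Γ) as → Formula L Γ
  ⊥′             : Formula L Γ
  _∧′_ _∨′_ _⇒′_ : Formula L Γ → Formula L Γ → Formula L Γ
  ∀′_ ∃′_        : ∀ {s} → Formula L (s ∷ Γ) → Formula L Γ

Sentence : {S : Set} → Language S a → Set a
Sentence L = Formula L []

module _ {S : Set} {L : Language S a} (M : Structure L c) where

  Env : List S → Set c
  Env Γ = All (Carrier M) Γ

  mutual
    eval : ∀ {Γ s} → Env Γ → Term L Γ s → Carrier M s
    eval ρ (var x)    = All.lookup ρ x
    eval ρ (app g ts) = fun (interp M) g (evals ρ ts)

    evals : ∀ {Γ as} → Env Γ → All (Term L Γ) as → Env as
    evals ρ []       = []
    evals ρ (t ∷ ts) = eval ρ t ∷ evals ρ ts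

  infix 2 _⊨_[_]

  _⊨_[_] : ∀ {Γ} → Formula L Γ → Env Γ → Set c
  _⊨_[_] (t ≐ u)     ρ = eval ρ t ≡ eval ρ u
  _⊨_[_] (atom R ts) ρ = rel (interp M) R (evals ρ ts)
  _⊨_[_] ⊥′          ρ = Lift c ⊥
  _⊨_[_] (φ ∧′ ψ)    ρ = _⊨_[_] φ ρ × _⊨_[_] ψ ρ
  _⊨_[_] (φ ∨′ ψ)    ρ = _⊨_[_] φ ρ ⊎ _⊨_[_] ψ ρ
  _⊨_[_] (φ ⇒′ ψ)    ρ = _⊨_[_] φ ρ → _⊨_[_] ψ ρ
  _⊨_[_] (∀′ φ)      ρ = ∀ x → _⊨_[_] φ (x ∷ ρ)
  _⊨_[_] (∃′ φ)      ρ = ∃[ x ] _⊨_[_] φ (x ∷ ρ)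

-- M ≼ N: N is an elementary extension of M, up to an embedding.
record _≼_ {S : Set} {L : Language S a} (M : Structure L c) (N : Structure L c′) :
           Set (a ⊔ c ⊔ c′) where
  field
    embed      : ∀ {s} → Carrier M s → Carrier N s
    elementary : ∀ {Γ} (φ : Formula L Γ) (ρ : Env M Γ) →
                 (M ⊨ φ [ ρ ]) ⇔ (N ⊨ φ [ All.map embed ρ ])
open _≼_ public

record Automorphism {S : Set} {L : Language S a} (M : Structure L c) : Set (a ⊔ c) where
  field
    to        : ∀ {s} → Carrier M s → Carrier M s
    bijective : ∀ {s} → Bijective _≡_ _≡_ (to {s})
    fun-hom   : ∀ {as s} (g : Fun L as s) (xs : All (Carrier M) as) →
                to (fun (interp M) g xs) ≡ fun (interp M) g (All.map to xs)
    rel-hom   : ∀ {as} (R : Rel L as) (xs : All (Carrier M) as) →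
                rel (interp M) R xs ⇔ rel (interp M) R (All.map to xs)
open Automorphism public

-- A family of parameters (Aᵢ) of sorts σ i, named by new constants.
data ConstSym {S : Set} {I : Set ℓ} (σ : I → S) : List S → S → Set ℓ where
  const : ∀ i → ConstSym σ [] (σ i)

Constants : {S : Set} {I : Set ℓ} → (I → S) → Language S ℓ
Constants {ℓ = ℓ} σ = record { Fun = ConstSym σ ; Rel = λ _ → Lift ℓ ⊥ }

module _ {S : Set} {L : Language S a} (M : Structure L c)
         {I : Set ℓ} {σ : I → S} (A : ∀ i → Carrier M (σ i)) where

  constants : Interpretation (Constants σ) (Carrier M)
  constants = record { fun = λ { (const i) [] → A i } ; rel = λ () }

  _⟪_⟫ : Structure (L ⊕ Constants σ) c
  _⟪_⟫ = structure (Carrier M) (interp M ⊕ᴵ constants)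

-- |A| < |B|
_≺_ : Set ℓ → Set ℓ′ → Set (ℓ ⊔ ℓ′)
A ≺ B = (A ↣ B) × ¬ (B ↣ A)

-- The cardinal κ is given by a type of that cardinality.
module _ {S : Set} {L : Language S ℓ} (κ : Set ℓ) (M : Structure L ℓ) where

  -- Realizing every set of formulas over A that is finitely satisfiable in M,
  -- complete or not.
  Saturated : Set (lsuc ℓ)
  Saturated = ∀ (I : Set ℓ) → I ≺ κ → (σ : I → S) (A : ∀ i → Carrier M (σ i)) →
    ∀ Γ (p : Pred (Formula (L ⊕ Constants σ) Γ) ℓ) →
    (∀ φs → All p φs → ∃[ ρ ] All (λ φ → (M ⟪ A ⟫) ⊨ φ [ ρ ]) φs) →
    ∃[ ρ ] ∀ φ → p φ → (M ⟪ A ⟫) ⊨ φ [ ρ ]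

  -- The hypothesis on A and B says that A i ↦ B i is an elementary map.
  StronglyHomogeneous : Set (lsuc ℓ)
  StronglyHomogeneous = ∀ (I : Set ℓ) → I ≺ κ →
    (σ : I → S) (A B : ∀ i → Carrier M (σ i)) →
    (∀ (φ : Sentence (L ⊕ Constants σ)) →
      ((M ⟪ A ⟫) ⊨ φ [ [] ]) ⇔ ((M ⟪ B ⟫) ⊨ φ [ [] ])) →
    Σ[ θ ∈ Automorphism M ] ∀ i → to θ (A i) ≡ B i

  -- |Sentence L| = |L| + ℵ₀, so κ is in particular uncountable.
  record Monster : Set (lsuc ℓ) where
    field
      large               : Sentence L ≺ κ
      saturated           : Saturated
      stronglyHomogeneous : StronglyHomogeneous

module _ (G : Group c c′) where
  open Group G using (_≈_; _∙_; ε; _⁻¹) renaming (Carrier to ∣G∣)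

  record IsSubgroup (K : Pred ∣G∣ ℓ) : Set (c ⊔ c′ ⊔ ℓ) where
    field
      resp      : ∀ {x y} → x ≈ y → K x → K y
      ε-closed  : K ε
      ∙-closed  : ∀ {x y} → K x → K y → K (x ∙ y)
      ⁻¹-closed : ∀ {x} → K x → K (x ⁻¹)

  data Generated (X : Pred ∣G∣ ℓ) : Pred ∣G∣ (c ⊔ c′ ⊔ ℓ) where
    gen   : ∀ {x} → X x → Generated X x
    resp  : ∀ {x y} → x ≈ y → Generated X x → Generated X y
    one   : Generated X ε
    mult  : ∀ {x y} → Generated X x → Generated X y → Generated X (x ∙ y)
    inv   : ∀ {x} → Generated X x → Generated X (x ⁻¹)

  Power : Pred ∣G∣ ℓ → ℕ → Pred ∣G∣ (c ⊔ c′ ⊔ ℓ)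
  Power {ℓ} X zero    g = Lift (c ⊔ ℓ) (g ≈ ε)
  Power     X (suc m) g = ∃[ x ] ∃[ y ] X x × Power X m y × g ≈ x ∙ y

  -- K has fewer than κ left cosets in H; the r i represent all of them,
  -- possibly with repetitions.
  BoundedIndex : Set ℓ → (H K : Pred ∣G∣ ℓ) → Set (c ⊔ lsuc ℓ)
  BoundedIndex {ℓ} κ H K = Σ[ I ∈ Set ℓ ] (I ≺ κ) × Σ[ r ∈ (I → ∣G∣) ]
    (∀ i → H (r i)) × (∀ h → H h → ∃[ i ] K (r i ⁻¹ ∙ h))

data Sort : Set where
  𝔽 ℤs : Sort

data BaseFun : List Sort → Sort → Set where
  mulS : BaseFun (𝔽 ∷ 𝔽 ∷ []) 𝔽
  addS : BaseFun (ℤs ∷ ℤs ∷ []) ℤs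
  fS   : BaseFun (𝔽 ∷ []) ℤs

Base : Language Sort 0ℓ
Base = record { Fun = BaseFun ; Rel = λ _ → ⊥ }

StdCarrier : Sort → Set
StdCarrier 𝔽  = F₂
StdCarrier ℤs = ℤ

base : (F₂ → ℤ) → Interpretation Base StdCarrier
base f = record
  { fun = λ where
      mulS (g ∷ h ∷ []) → g · h
      addS (x ∷ y ∷ []) → x ℤ.+ y
      fS   (g ∷ [])     → f g
  ; rel = λ ()
  }

-- The expansion of (F₂, ℤ, f) by the symbols of L, interpreted by E.
Std : {L : Language Sort ℓ} → (F₂ → ℤ) → Interpretation L StdCarrier →
      Structure (Base ⊕ L) 0ℓ
Std f E = structure StdCarrier (base f ⊕ᴵ E)

-- The language has no symbols for units and inverses, so the group structure
-- on a sort of an elementary extension comes from transferring this sentence.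
groupAxioms : {S : Set} {L : Language S ℓ} {s : S} → Fun L (s ∷ s ∷ []) s → Sentence L
groupAxioms {L = L} {s} op =
  (∀′ ∀′ ∀′ ((z ∗ y) ∗ x ≐ z ∗ (y ∗ x)))
  ∧′ (∃′ ∀′ ((y ∗ x ≐ x) ∧′ (x ∗ y ≐ x) ∧′ (∃′ ((x ∗ y ≐ z) ∧′ (y ∗ x ≐ z)))))
  where
  _∗_ : ∀ {Γ} → Term L Γ s → Term L Γ s → Term L Γ s
  t ∗ u = app op (t ∷ u ∷ [])
  x : ∀ {Γ} → Term L (s ∷ Γ) s
  x = var (here refl)
  y : ∀ {r Γ} → Term L (r ∷ s ∷ Γ) s
  y = var (there (here refl))
  z : ∀ {q r Γ} → Term L (q ∷ r ∷ s ∷ Γ) s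
  z = var (there (there (here refl)))

module _ {S : Set} {L : Language S ℓ} (M : Structure L c) {s : S} (op : Fun L (s ∷ s ∷ []) s) where

  groupOf : M ⊨ groupAxioms op [ [] ] → Group c c
  groupOf (assoc , e , unit) = record
    { Carrier = Carrier M s ; _≈_ = _≡_
    ; _∙_ = _∙_
    ; ε = e
    ; _⁻¹ = λ x → proj₁ (proj₂ (proj₂ (unit x)))
    ; isGroup = record
      { isMonoid = record
        { isSemigroup = record
          { isMagma = record { isEquivalence = isEquivalence ; ∙-cong = cong₂ _∙_ }
          ; assoc = assoc
          }
        ; identity = (λ x → proj₁ (unit x)) , (λ x → proj₁ (proj₂ (unit x)))
        }
      ; inverse = (λ x → proj₁ (proj₂ (proj₂ (proj₂ (unit x)))))
                , (λ x → proj₂ (proj₂ (proj₂ (proj₂ (unit x)))))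
      ; ⁻¹-cong = cong λ x → proj₁ (proj₂ (proj₂ (unit x)))
      }
    }
    where
    _∙_ : Carrier M s → Carrier M s → Carrier M s
    x ∙ y = fun (interp M) op (x ∷ y ∷ [])

module _ {f : F₂ → ℤ} {L : Language Sort ℓ} {E : Interpretation L StdCarrier}
         (M* : Structure (Base ⊕ L) ℓ) (ext : Std f E ≼ M*) where

  F₂* : Group ℓ ℓ
  F₂* = groupOf M* (inj₁ mulS) (Equivalence.to (elementary ext (groupAxioms (inj₁ mulS)) [])
    ( assoc
    , ε , λ x → identityˡ x , identityʳ x , x ⁻¹ , inverseˡ x , inverseʳ x))
    where open Group F₂-group

  ℤ* : Group ℓ ℓ
  ℤ* = groupOf M* (inj₁ addS) (Equivalence.to (elementary ext (groupAxioms (inj₁ addS)) [])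
    ( assoc
    , ε , λ x → identityˡ x , identityʳ x , x ⁻¹ , inverseˡ x , inverseʳ x))
    where open Group ℤ-group

  F₂*×ℤ* : Group ℓ ℓ
  F₂*×ℤ* = F₂* ×ᴳ ℤ*

  f* : Carrier M* 𝔽 → Carrier M* ℤs
  f* g = fun (interp M*) (inj₁ fS) (g ∷ [])

  X H : Pred (Group.Carrier F₂*×ℤ*) ℓ
  X (g , z) = z ≡ f* g
  H = Generated F₂*×ℤ* X

  AutInvariant : Pred (Group.Carrier F₂*×ℤ*) ℓ → Set ℓ
  AutInvariant K = ∀ (θ : Automorphism M*) {g z} → K (g , z) → K (to θ g , to θ z)

  record InvariantBounded (κ : Set ℓ) (K : Pred (Group.Carrier F₂*×ℤ*) ℓ) : Set (lsuc ℓ) where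
    field
      subgroup  : IsSubgroup F₂*×ℤ* K
      inside    : K ⊆ H
      invariant : AutInvariant K
      bounded   : BoundedIndex F₂*×ℤ* κ H K

  -- K is the smallest Aut(M*)-invariant subgroup of H of bounded index in H.
  record IsH⁰⁰⁰ (κ : Set ℓ) (K : Pred (Group.Carrier F₂*×ℤ*) ℓ) : Set (lsuc ℓ) where
    field
      invariantBounded : InvariantBounded κ K
      smallest         : ∀ K′ → InvariantBounded κ K′ → K ⊆ K′

{-# OPTIONS --safe #-}
module Submission where

-- f is a quasimorphism, so the elements (g , z) of Xᵐ have f*(g) - z bounded
-- by an integer depending on m only.  On the other hand, let v be a value that
-- α takes infinitely often.  By saturation and bounded index there are x, y in
-- the centralizer of a with f*(x) = f*(y) = v and f*(y⁻¹x) ≠ 0 such that the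
-- points of X above xbx and yby lie in the same coset of K.  Then (u , 0) ∈ K
-- for u = (yby)⁻¹(xbx) = y⁻¹b⁻¹(y⁻¹x)bx, and f*(uᵏ) = (2k - 1) f*(y⁻¹x) is
-- unbounded in k.

open import Defs
open import Algebra.Bundles using (Group)
open import Algebra.Definitions.RawMonoid using (sum)
import Algebra.Properties.Group as GroupProperties
import Algebra.Properties.Monoid.Mult as MonoidMult
open import Axiom.ExcludedMiddle using (ExcludedMiddle)
open import Data.Bool.Base using (true; false)
open import Data.Empty using (⊥; ⊥-elim)
open import Data.Fin.Base using (Fin; zero; suc; inject₁)
open import Data.Integer.Base as ℤ using (ℤ; +_; -[1+_]; ∣_∣)
import Data.Integer.Properties as ℤₚ
open import Data.Integer.Tactic.RingSolver using (solve-∀)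
open import Data.List.Base using (List; []; _∷_; foldr; _ʳ++_)
open import Data.List.Membership.Propositional using (_∉_)
open import Data.List.Properties using (ʳ++-ʳ++; ++-identityʳ)
open import Data.List.Relation.Unary.All as All using (All; []; _∷_)
open import Data.List.Relation.Unary.Any using (here; there)
open import Data.List.Relation.Unary.Linked as Linked using (Linked; []; [-]; _∷_)
open import Data.Nat.Base as ℕ using (ℕ; zero; suc; _≥_)
import Data.Nat.Properties as ℕₚ
open import Data.Product.Base using (∃-syntax; _×_; _,_; proj₁; proj₂)
open import Data.Sum.Base using (_⊎_; inj₁; inj₂; [_,_]′)
open import Data.Vec.Functional as Vector using (Vector)
open import Function.Base using (id)
open import Function.Bundles using (Equivalence)
open import Level using (0ℓ; Lift; lift; lower)
open import Relation.Binary.Definitions using (tri<; tri≈; tri>)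
open import Relation.Binary.PropositionalEquality hiding (resp)
import Relation.Binary.Reasoning.Setoid as SetoidReasoning
open import Relation.Nullary using (¬_; yes; no)
open import Relation.Nullary.Decidable using (map′; decidable-stable)
open import Relation.Unary using (Pred; _⊆_; _⊈_)

open Group F₂-group using (assoc; identityʳ; inverseˡ; inverseʳ)
open GroupProperties F₂-group using (⁻¹-anti-homo-∙; ∙-cancelˡ; \\-leftDividesˡ; \\-leftDividesʳ)
open MonoidMult (Group.monoid F₂-group) using () renaming (_×_ to _×ᵖ_)

-- Powers in F₂

-- The b in the middle and the x on both sides are what make f unbounded on the powers of u. Points
-- above x alone would give the quotient y⁻¹x, a power of a, and points above xb would give its
-- conjugate b⁻¹(y⁻¹x)b; all powers of these have at most three syllables, so f stays bounded on
-- them. At each junction of uᵏ, however, x·y⁻¹ is another copy of y⁻¹x, and letters b±¹ keep the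
-- copies apart, so their weights add up.
--
-- Since x and y live in M*, whatever is used about them has to be a first-order statement with
-- standard parameters that can be checked in M. The type to be realized demands f(y⁻¹x) ≠ 0 for a y
-- chosen in advance for each coset. It is finitely satisfied by powers of a whose exponents lie so
-- far apart that, α having only finitely many zeros, each y spoils at most one of them.

power-comm : ∀ g n → g · (n ×ᵖ g) ≡ (n ×ᵖ g) · g
power-comm g zero    = identityʳ g
power-comm g (suc n) = trans (cong (g ·_) (power-comm g n)) (sym (assoc g (n ×ᵖ g) g))

^ᶻ-suc : ∀ g i → g ^ᶻ ℤ.suc i ≡ g · (g ^ᶻ i)
^ᶻ-suc g (+ n)          = refl
^ᶻ-suc g -[1+ zero ]    = sym (trans (cong (λ h → g · (h ⁻¹F)) (identityʳ g)) (inverseʳ g))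
-- Inverting g · gⁿ⁺¹ puts g⁻¹ on the right; `power-comm` brings it to the left, where it cancels.
^ᶻ-suc g -[1+ suc n ]   = begin
  (suc n ×ᵖ g) ⁻¹F                         ≡⟨ \\-leftDividesˡ g _ ⟨
  g · ((g ⁻¹F) · ((suc n ×ᵖ g) ⁻¹F))       ≡⟨ cong (g ·_) (⁻¹-anti-homo-∙ (suc n ×ᵖ g) g) ⟨
  g · (((suc n ×ᵖ g) · g) ⁻¹F)             ≡⟨ cong (λ h → g · (h ⁻¹F)) (power-comm g (suc n)) ⟨
  g · ((suc (suc n) ×ᵖ g) ⁻¹F)             ∎
  where open ≡-Reasoning

^ᶻ-pred : ∀ g i → g ^ᶻ ℤ.pred i ≡ (g ⁻¹F) · (g ^ᶻ i)
^ᶻ-pred g i = begin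
  g ^ᶻ ℤ.pred i                         ≡⟨ \\-leftDividesʳ g _ ⟨
  (g ⁻¹F) · (g · (g ^ᶻ ℤ.pred i))       ≡⟨ cong ((g ⁻¹F) ·_) (^ᶻ-suc g (ℤ.pred i)) ⟨
  (g ⁻¹F) · (g ^ᶻ ℤ.suc (ℤ.pred i))     ≡⟨ cong (λ j → (g ⁻¹F) · (g ^ᶻ j)) (ℤₚ.suc-pred i) ⟩
  (g ⁻¹F) · (g ^ᶻ i)                    ∎
  where open ≡-Reasoning

^ᶻ-+ : ∀ g i j → g ^ᶻ (i ℤ.+ j) ≡ (g ^ᶻ i) · (g ^ᶻ j)
^ᶻ-+ g (+ zero)  j = cong (g ^ᶻ_) (ℤₚ.+-identityˡ j)
^ᶻ-+ g (+ suc n) j = begin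
  g ^ᶻ (ℤ.suc (+ n) ℤ.+ j)          ≡⟨ cong (g ^ᶻ_) (ℤₚ.+-assoc (+ 1) (+ n) j) ⟩
  g ^ᶻ ℤ.suc (+ n ℤ.+ j)            ≡⟨ ^ᶻ-suc g (+ n ℤ.+ j) ⟩
  g · (g ^ᶻ (+ n ℤ.+ j))            ≡⟨ cong (g ·_) (^ᶻ-+ g (+ n) j) ⟩
  g · ((g ^ᶻ + n) · (g ^ᶻ j))       ≡⟨ assoc g (g ^ᶻ + n) (g ^ᶻ j) ⟨
  (g ^ᶻ + suc n) · (g ^ᶻ j)         ∎
  where open ≡-Reasoning
^ᶻ-+ g -[1+ zero ] j = trans (^ᶻ-pred g j) (cong (λ h → (h ⁻¹F) · (g ^ᶻ j)) (sym (identityʳ g)))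
^ᶻ-+ g -[1+ suc n ] j = begin
  g ^ᶻ (ℤ.pred -[1+ n ] ℤ.+ j)               ≡⟨ cong (g ^ᶻ_) (ℤₚ.+-assoc (ℤ.- + 1) -[1+ n ] j) ⟩
  g ^ᶻ ℤ.pred (-[1+ n ] ℤ.+ j)               ≡⟨ ^ᶻ-pred g (-[1+ n ] ℤ.+ j) ⟩
  (g ⁻¹F) · (g ^ᶻ (-[1+ n ] ℤ.+ j))          ≡⟨ cong ((g ⁻¹F) ·_) (^ᶻ-+ g -[1+ n ] j) ⟩
  (g ⁻¹F) · ((g ^ᶻ -[1+ n ]) · (g ^ᶻ j))     ≡⟨ assoc (g ⁻¹F) (g ^ᶻ -[1+ n ]) (g ^ᶻ j) ⟨
  ((g ⁻¹F) · (g ^ᶻ -[1+ n ])) · (g ^ᶻ j)     ≡⟨ cong (_· (g ^ᶻ j)) (^ᶻ-pred g -[1+ n ]) ⟨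
  (g ^ᶻ -[1+ suc n ]) · (g ^ᶻ j)             ∎
  where open ≡-Reasoning

^ᶻ-merge : ∀ g i j h → (g ^ᶻ i) · ((g ^ᶻ j) · h) ≡ (g ^ᶻ (i ℤ.+ j)) · h
^ᶻ-merge g i j h = trans (sym (assoc (g ^ᶻ i) (g ^ᶻ j) h)) (cong (_· h) (sym (^ᶻ-+ g i j)))

^ᶻ-comm : ∀ g i j → (g ^ᶻ i) · (g ^ᶻ j) ≡ (g ^ᶻ j) · (g ^ᶻ i)
^ᶻ-comm g i j = trans (sym (^ᶻ-+ g i j)) (trans (cong (g ^ᶻ_) (ℤₚ.+-comm i j)) (^ᶻ-+ g j i))

letter : Letter → F₂
letter x = mk (x ∷ []) [-]

◁-reduced-≡ : ∀ x {w} → Reduced (x ∷ w) → x ◁ w ≡ x ∷ w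
◁-reduced-≡ x {[]}    r = refl
◁-reduced-≡ x {y ∷ w} (y≢x⁻¹ ∷ r) with y ≟ˡ opp x
... | yes p = ⊥-elim (y≢x⁻¹ p)
... | no  _ = refl

letter-· : ∀ x w (r : Reduced (x ∷ w)) → mk (x ∷ w) r ≡ letter x · mk w (Linked.tail r)
letter-· x w r = F₂-≡ (sym (◁-reduced-≡ x r))

generator : Gen → F₂
generator c = letter (c , true)

letter-power : ∀ x → ∃[ e ] e ≢ + 0 × letter x ≡ generator (proj₁ x) ^ᶻ e
letter-power (ga , true)  = + 1 , (λ ()) , refl
letter-power (ga , false) = -[1+ 0 ] , (λ ()) , refl
letter-power (gb , true)  = + 1 , (λ ()) , refl
letter-power (gb , false) = -[1+ 0 ] , (λ ()) , refl

-- The centralizer of a nontrivial power of a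

AWord : List Letter → Set
AWord = All λ x → proj₁ x ≡ ga

◁-AWord : ∀ {x w} → proj₁ x ≡ ga → AWord w → AWord (x ◁ w)
◁-AWord {w = []} p q = p ∷ []
◁-AWord {x} {y ∷ w} p (q ∷ qs) with y ≟ˡ opp x
... | yes _ = qs
... | no  _ = p ∷ q ∷ qs

b◁AWord : ∀ {x w} → proj₁ x ≡ gb → AWord w → x ◁ w ≡ x ∷ w
b◁AWord {w = []} p q = refl
b◁AWord {x} {y ∷ w} refl (refl ∷ qs) with y ≟ˡ opp x
... | yes ()
... | no  _ = refl

-- Recording the first letter is enough: it decides whether a letter put in front of the word
-- cancels.
data SameHead : List Letter → List Letter → Set where
  head : ∀ {x u v} → SameHead (x ∷ u) (x ∷ v)

-- Right multiplication by a power of a cannot cancel the first letter of w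
-- unless w is itself a power of a.
◁*-AWord : ∀ {w v} → Reduced w → AWord v → (AWord w × AWord (w ◁* v)) ⊎ SameHead w (w ◁* v)
◁*-AWord {[]} r q = inj₁ ([] , q)
◁*-AWord {x ∷ w} {v} r q with ◁*-AWord {w} {v} (Linked.tail r) q
◁*-AWord {(ga , s) ∷ w} r q | inj₁ (p , p′) = inj₁ (refl ∷ p , ◁-AWord refl p′)
◁*-AWord {(gb , s) ∷ w} r q | inj₁ (p , p′) rewrite b◁AWord {gb , s} refl p′ = inj₂ head
◁*-AWord {x ∷ y ∷ w} {v} (y≢x⁻¹ ∷ r) q | inj₂ h with (y ∷ w) ◁* v
◁*-AWord {x ∷ y ∷ w} {v} (y≢x⁻¹ ∷ r) q | inj₂ head | _ with y ≟ˡ opp x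
... | yes p = ⊥-elim (y≢x⁻¹ p)
... | no  _ = inj₂ head

-- The last letter of u meets b±¹ and every other letter its old neighbour in a reduced word, so
-- nothing cancels.
AWord-◁* : ∀ {u s v} → Reduced u → AWord u → Reduced ((gb , s) ∷ v) →
           u ≡ [] ⊎ SameHead u (u ◁* ((gb , s) ∷ v))
AWord-◁* {[]} r q t = inj₁ refl
AWord-◁* {x ∷ u} r (refl ∷ q) t with AWord-◁* {u} (Linked.tail r) q t
AWord-◁* {x ∷ .[]} {s} r (refl ∷ q) t | inj₁ refl with (gb , s) ≟ˡ opp x
... | yes ()
... | no  _ = inj₂ head
AWord-◁* {x ∷ y ∷ u} {s} {v} (y≢x⁻¹ ∷ r) (refl ∷ q) t | inj₂ h with (y ∷ u) ◁* ((gb , s) ∷ v)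
AWord-◁* {x ∷ y ∷ u} (y≢x⁻¹ ∷ r) (refl ∷ q) t | inj₂ head | _ with y ≟ˡ opp x
... | yes p = ⊥-elim (y≢x⁻¹ p)
... | no  _ = inj₂ head

AWord⇒power : ∀ w (r : Reduced w) → AWord w → ∃[ n ] mk w r ≡ a₁ ^ᶻ n
AWord⇒power []      r q = + 0 , refl
AWord⇒power ((ga , s) ∷ w) r (refl ∷ q) with AWord⇒power w (Linked.tail r) q | letter-power (ga , s)
... | n , w≡aⁿ | e , _ , x≡aᵉ = e ℤ.+ n ,
  trans (letter-· (ga , s) w r) (trans (cong₂ _·_ x≡aᵉ w≡aⁿ) (sym (^ᶻ-+ a₁ e n)))

-- Letters a±¹ at the front of w are stripped one at a time.  If w begins with
-- b±¹, then w y begins with b±¹ but y w begins with a±¹.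
centralizer-AWord : ∀ w (r : Reduced w) (y : F₂) → AWord (word y) → word y ≢ [] →
                    mk w r · y ≡ y · mk w r → AWord w
centralizer-AWord [] r y q y≢[] comm = []
centralizer-AWord ((gb , s) ∷ w) r y q y≢[] comm with ◁*-AWord r q | AWord-◁* (reduced′ y) q r
... | inj₁ (() ∷ _ , _) | _
... | inj₂ _ | inj₁ y≡[] = ⊥-elim (y≢[] y≡[])
... | inj₂ h | inj₂ h′ = ⊥-elim (clash q h h′ (cong word comm))
  where
  clash : ∀ {y u v t} → AWord y → SameHead ((gb , s) ∷ t) u → SameHead y v → u ≢ v
  clash (refl ∷ _) head head ()
centralizer-AWord ((ga , s) ∷ w) r y q y≢[] comm =
  refl ∷ centralizer-AWord w (Linked.tail r) y q y≢[] (∙-cancelˡ x (g · y) (y · g) (begin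
    x · (g · y)  ≡⟨ assoc x g y ⟨
    (x · g) · y  ≡⟨ cong (_· y) (letter-· (ga , s) w r) ⟨
    mk _ r · y   ≡⟨ comm ⟩
    y · mk _ r   ≡⟨ cong (y ·_) (letter-· (ga , s) w r) ⟩
    y · (x · g)  ≡⟨ assoc y x g ⟨
    (y · x) · g  ≡⟨ cong (_· g) yx≡xy ⟩
    (x · y) · g  ≡⟨ assoc x y g ⟩
    x · (y · g)  ∎))
  where
  open ≡-Reasoning
  x = letter (ga , s)
  g = mk w (Linked.tail r)
  yx≡xy : y · x ≡ x · y
  yx≡xy with AWord⇒power (word y) (reduced′ y) q | letter-power (ga , s)
  ... | n , y≡aⁿ | e , _ , x≡aᵉ = begin
    y · x                    ≡⟨ cong₂ _·_ y≡aⁿ x≡aᵉ ⟩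
    (a₁ ^ᶻ n) · (a₁ ^ᶻ e)    ≡⟨ ^ᶻ-comm a₁ n e ⟩
    (a₁ ^ᶻ e) · (a₁ ^ᶻ n)    ≡⟨ cong₂ _·_ x≡aᵉ y≡aⁿ ⟨
    x · y                    ∎

commutes-a⇒AWord : ∀ y → y · a₁ ≡ a₁ · y → AWord (word y)
commutes-a⇒AWord y = centralizer-AWord (word y) (reduced′ y) a₁ (refl ∷ []) (λ ())

commutes-a⇒power : ∀ y → y · a₁ ≡ a₁ · y → ∃[ n ] y ≡ a₁ ^ᶻ n
commutes-a⇒power y comm = AWord⇒power (word y) (reduced′ y) (commutes-a⇒AWord y comm)

commutes-trans : ∀ x y → y · a₁ ≡ a₁ · y → y ≢ 1F → x · y ≡ y · x → ∃[ n ] x ≡ a₁ ^ᶻ n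
commutes-trans x y ya≡ay y≢1 xy≡yx = AWord⇒power (word x) (reduced′ x)
  (centralizer-AWord (word x) (reduced′ x) y (commutes-a⇒AWord y ya≡ay)
    (λ y≡[] → y≢1 (F₂-≡ y≡[])) xy≡yx)

a-commutes : ∀ n → (a₁ ^ᶻ n) · a₁ ≡ a₁ · (a₁ ^ᶻ n)
a-commutes n = ^ᶻ-comm a₁ n (+ 1)

-- Syllables

Syllable : Set
Syllable = Gen × ℤ

⟦_⟧ : List Syllable → F₂
⟦ [] ⟧          = 1F
⟦ (c , i) ∷ l ⟧ = (generator c ^ᶻ i) · ⟦ l ⟧

Alternating : List Syllable → Set
Alternating = Linked λ s t → proj₁ s ≢ proj₁ t

Nonzero : List Syllable → Set
Nonzero = All λ s → proj₂ s ≢ + 0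

Normal : List Syllable → Set
Normal l = Alternating l × Nonzero l

Normal-tail : ∀ {s l} → Normal (s ∷ l) → Normal l
Normal-tail (r , _ ∷ z) = Linked.tail r , z

relabel : ∀ {c i j l} → Alternating ((c , i) ∷ l) → Alternating ((c , j) ∷ l)
relabel [-]     = [-]
relabel (n ∷ r) = n ∷ r

⟦⟧-ʳ++-cong : ∀ l {r r′} → ⟦ r ⟧ ≡ ⟦ r′ ⟧ → ⟦ l ʳ++ r ⟧ ≡ ⟦ l ʳ++ r′ ⟧
⟦⟧-ʳ++-cong []            p = p
⟦⟧-ʳ++-cong ((c , i) ∷ l) p = ⟦⟧-ʳ++-cong l (cong ((generator c ^ᶻ i) ·_) p)

⟦⟧-ʳ++ : ∀ l r → ⟦ l ʳ++ r ⟧ ≡ ⟦ l ʳ++ [] ⟧ · ⟦ r ⟧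
⟦⟧-ʳ++ []            r = refl
⟦⟧-ʳ++ (s@(c , i) ∷ l) r = begin
  ⟦ l ʳ++ (s ∷ r) ⟧                                ≡⟨ ⟦⟧-ʳ++ l (s ∷ r) ⟩
  ⟦ l ʳ++ [] ⟧ · ((generator c ^ᶻ i) · ⟦ r ⟧)      ≡⟨ assoc ⟦ l ʳ++ [] ⟧ (generator c ^ᶻ i) ⟦ r ⟧ ⟨
  (⟦ l ʳ++ [] ⟧ · (generator c ^ᶻ i)) · ⟦ r ⟧      ≡⟨ cong (λ h → (⟦ l ʳ++ [] ⟧ · h) · ⟦ r ⟧) (identityʳ (generator c ^ᶻ i)) ⟨
  (⟦ l ʳ++ [] ⟧ · ⟦ s ∷ [] ⟧) · ⟦ r ⟧              ≡⟨ cong (_· ⟦ r ⟧) (⟦⟧-ʳ++ l (s ∷ [])) ⟨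
  ⟦ (s ∷ l) ʳ++ [] ⟧ · ⟦ r ⟧                       ∎
  where open ≡-Reasoning

-- The common head `s` links the reversed list to `r`; the induction only moves this pivot, as being
-- different is symmetric.
Alternating-ʳ++ : ∀ l {s r} → Alternating (s ∷ l) → Alternating (s ∷ r) → Alternating (l ʳ++ (s ∷ r))
Alternating-ʳ++ []      p       q = q
Alternating-ʳ++ (t ∷ l) (n ∷ p) q = Alternating-ʳ++ l p (≢-sym n ∷ q)

Nonzero-ʳ++ : ∀ l {r} → Nonzero l → Nonzero r → Nonzero (l ʳ++ r)
Nonzero-ʳ++ []      _       q = q
Nonzero-ʳ++ (s ∷ l) (z ∷ p) q = Nonzero-ʳ++ l p (z ∷ q)

Normal-ʳ++ : ∀ l {s r} → Normal (s ∷ l) → Normal (s ∷ r) → Normal (l ʳ++ (s ∷ r))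
Normal-ʳ++ l (p , _ ∷ y) (q , z) = Alternating-ʳ++ l p q , Nonzero-ʳ++ l y z

Normal-reverse : ∀ l → Normal l → Normal (l ʳ++ [])
Normal-reverse []      p           = p
Normal-reverse (s ∷ l) p@(_ , z ∷ _) = Normal-ʳ++ l p ([-] , z ∷ [])

normal-push : ∀ c e l → e ≢ + 0 → Normal l → ∃[ l′ ] Normal l′ × ⟦ l′ ⟧ ≡ (generator c ^ᶻ e) · ⟦ l ⟧
normal-push c e [] e≢0 p = (c , e) ∷ [] , ([-] , e≢0 ∷ []) , refl
normal-push c e l₀@((d , j) ∷ l) e≢0 p@(r , z) with c ≟ᵍ d
... | no c≢d = (c , e) ∷ l₀ , (c≢d ∷ r , e≢0 ∷ z) , refl
... | yes refl with e ℤ.+ j ℤₚ.≟ + 0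
...   | yes e+j≡0 = l , Normal-tail p ,
        sym (trans (^ᶻ-merge (generator c) e j ⟦ l ⟧) (cong (λ k → (generator c ^ᶻ k) · ⟦ l ⟧) e+j≡0))
...   | no e+j≢0 = (c , e ℤ.+ j) ∷ l , (relabel r , e+j≢0 ∷ All.tail z) ,
        sym (^ᶻ-merge (generator c) e j ⟦ l ⟧)

normal-form-word : ∀ w (r : Reduced w) → ∃[ l ] Normal l × ⟦ l ⟧ ≡ mk w r
normal-form-word []      r = [] , ([] , []) , refl
normal-form-word (x ∷ w) r with normal-form-word w (Linked.tail r) | letter-power x
... | l , p , l≡w | e , e≢0 , x≡cᵉ with normal-push (proj₁ x) e l e≢0 p
...   | l′ , p′ , l′≡ = l′ , p′ ,
        trans l′≡ (trans (cong₂ _·_ (sym x≡cᵉ) l≡w) (sym (letter-· x w r)))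

normal-form : ∀ g → ∃[ l ] Normal l × ⟦ l ⟧ ≡ g
normal-form g = normal-form-word (word g) (reduced′ g)

-- Values of f

module Evaluation (α β : ℤ → ℤ) (f : F₂ → ℤ) (given : GivenBy α β f)
                  (α-odd : Odd α) (β-odd : Odd β) where

  odd-0 : ∀ {γ} → Odd γ → γ (+ 0) ≡ + 0
  odd-0 {γ} odd = self-neg (γ (+ 0)) (odd (+ 0))
    where
    self-neg : ∀ i → i ≡ ℤ.- i → i ≡ + 0
    self-neg (+ zero)  _  = refl
    self-neg (+ suc n) ()
    self-neg -[1+ n ]  ()

  weight : Syllable → ℤ
  weight (ga , i) = α i
  weight (gb , i) = β i

  total : List Syllable → ℤ
  total []      = + 0
  total (s ∷ l) = weight s ℤ.+ total l

  HeadExponent : List Syllable → ℤ → Set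
  HeadExponent []             n = n ≡ + 0
  HeadExponent ((ga , _) ∷ _) n = n ≢ + 0
  HeadExponent ((gb , _) ∷ _) n = n ≡ + 0

  -- head-n lets a further syllable be absorbed into the first block aⁿbᵐ.
  record Blocks (l : List Syllable) : Set where
    field
      k         : ℕ
      n m       : Vector ℤ (suc k)
      n≢0       : ∀ (i : Fin k) → n (suc i) ≢ + 0
      m≢0       : ∀ (i : Fin k) → m (inject₁ i) ≢ + 0
      head-n    : HeadExponent l (n zero)
      product≡  : sum (Group.rawMonoid F₂-group) (λ i → (a₁ ^ᶻ n i) · (b₁ ^ᶻ m i)) ≡ ⟦ l ⟧
      sum≡      : sum (Group.rawMonoid ℤ-group) (λ i → α (n i) ℤ.+ β (m i)) ≡ total l

  -- A leading b cannot join a block with a nonzero exponent of a, so it opens a block a⁰bʲ. The old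
  -- first block becomes an inner one, and `head-n` is then the condition required of it.
  cons-b-block : ∀ {i j l} → j ≢ + 0 → Blocks ((ga , i) ∷ l) → Blocks ((gb , j) ∷ (ga , i) ∷ l)
  cons-b-block {i} {j} {l} j≢0 bs = record
    { k = suc k ; n = + 0 Vector.∷ n ; m = j Vector.∷ m
    ; n≢0 = λ { zero → head-n ; (suc i) → n≢0 i }
    ; m≢0 = λ { zero → j≢0 ; (suc i) → m≢0 i }
    ; head-n = refl
    ; product≡ = cong ((b₁ ^ᶻ j) ·_) product≡
    ; sum≡ = cong₂ ℤ._+_ (trans (cong (ℤ._+ β j) (odd-0 α-odd)) (ℤₚ.+-identityˡ (β j))) sum≡
    }
    where open Blocks bs

  -- A word beginning with b has a first block a⁰bᵐ. Overwriting the exponent 0 by i adds the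
  -- syllable without a new block, and the lost summand is α(0) = 0.
  cons-a-block : ∀ {i j l} → i ≢ + 0 → Blocks ((gb , j) ∷ l) → Blocks ((ga , i) ∷ (gb , j) ∷ l)
  cons-a-block {i} {j} {l} i≢0 bs = record
    { k = k ; n = i Vector.∷ Vector.tail n ; m = m
    ; n≢0 = n≢0 ; m≢0 = m≢0 ; head-n = i≢0
    ; product≡ = begin
        ((a₁ ^ᶻ i) · (b₁ ^ᶻ m zero)) · rest
          ≡⟨ assoc (a₁ ^ᶻ i) (b₁ ^ᶻ m zero) rest ⟩
        (a₁ ^ᶻ i) · ((b₁ ^ᶻ m zero) · rest)
          ≡⟨ cong (λ e → (a₁ ^ᶻ i) · (((a₁ ^ᶻ e) · (b₁ ^ᶻ m zero)) · rest)) head-n ⟨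
        (a₁ ^ᶻ i) · (((a₁ ^ᶻ n zero) · (b₁ ^ᶻ m zero)) · rest)
          ≡⟨ cong ((a₁ ^ᶻ i) ·_) product≡ ⟩
        ⟦ (ga , i) ∷ (gb , j) ∷ l ⟧ ∎
    ; sum≡ = begin
        (α i ℤ.+ β (m zero)) ℤ.+ rest′
          ≡⟨ ℤₚ.+-assoc (α i) (β (m zero)) rest′ ⟩
        α i ℤ.+ (β (m zero) ℤ.+ rest′)
          ≡⟨ cong (λ e → α i ℤ.+ (e ℤ.+ rest′)) (ℤₚ.+-identityˡ (β (m zero))) ⟨
        α i ℤ.+ ((+ 0 ℤ.+ β (m zero)) ℤ.+ rest′)
          ≡⟨ cong (λ e → α i ℤ.+ ((e ℤ.+ β (m zero)) ℤ.+ rest′)) (trans (cong α head-n) (odd-0 α-odd)) ⟨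
        α i ℤ.+ ((α (n zero) ℤ.+ β (m zero)) ℤ.+ rest′)
          ≡⟨ cong (ℤ._+_ (α i)) sum≡ ⟩
        total ((ga , i) ∷ (gb , j) ∷ l) ∎
    }
    where
    open Blocks bs
    open ≡-Reasoning
    rest = sum (Group.rawMonoid F₂-group) (λ i → (a₁ ^ᶻ n (suc i)) · (b₁ ^ᶻ m (suc i)))
    rest′ = sum (Group.rawMonoid ℤ-group) (λ i → α (n (suc i)) ℤ.+ β (m (suc i)))

  blocks : ∀ l → Normal l → Blocks l
  blocks [] p = record
    { k = 0 ; n = λ _ → + 0 ; m = λ _ → + 0 ; n≢0 = λ () ; m≢0 = λ () ; head-n = refl
    ; product≡ = refl
    ; sum≡ = cong₂ (λ i j → (i ℤ.+ j) ℤ.+ + 0) (odd-0 α-odd) (odd-0 β-odd)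
    }
  blocks ((gb , j) ∷ []) p = record
    { k = 0 ; n = λ _ → + 0 ; m = λ _ → j ; n≢0 = λ () ; m≢0 = λ () ; head-n = refl
    ; product≡ = refl
    ; sum≡ = trans (cong (λ i → (i ℤ.+ β j) ℤ.+ + 0) (odd-0 α-odd)) (cong (ℤ._+ + 0) (ℤₚ.+-identityˡ (β j)))
    }
  blocks ((ga , i) ∷ []) p@(_ , i≢0 ∷ _) = record
    { k = 0 ; n = λ _ → i ; m = λ _ → + 0 ; n≢0 = λ () ; m≢0 = λ () ; head-n = i≢0
    ; product≡ = identityʳ ((a₁ ^ᶻ i) · 1F)
    ; sum≡ = cong (ℤ._+ + 0) (trans (cong (ℤ._+_ (α i)) (odd-0 β-odd)) (ℤₚ.+-identityʳ (α i)))
    }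
  blocks ((gb , _) ∷ (gb , _) ∷ _) (b≢b ∷ _ , _) = ⊥-elim (b≢b refl)
  blocks ((ga , _) ∷ (ga , _) ∷ _) (a≢a ∷ _ , _) = ⊥-elim (a≢a refl)
  blocks ((gb , j) ∷ (ga , i) ∷ l) p@(_ , j≢0 ∷ _) = cons-b-block j≢0 (blocks ((ga , i) ∷ l) (Normal-tail p))
  blocks ((ga , i) ∷ (gb , j) ∷ l) p@(_ , i≢0 ∷ _) = cons-a-block i≢0 (blocks ((gb , j) ∷ l) (Normal-tail p))

  f-normal : ∀ l → Normal l → f ⟦ l ⟧ ≡ total l
  f-normal l p = trans (cong f (sym product≡)) (trans (given k n m n≢0 m≢0) sum≡)
    where open Blocks (blocks l p)

  f-1 : f 1F ≡ + 0
  f-1 = f-normal [] ([] , [])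

  f-a : ∀ n → f (a₁ ^ᶻ n) ≡ α n
  f-a n with n ℤₚ.≟ + 0
  ... | yes refl = trans f-1 (sym (odd-0 α-odd))
  ... | no n≢0   = trans (cong f (sym (identityʳ (a₁ ^ᶻ n))))
                     (trans (f-normal ((ga , n) ∷ []) ([-] , n≢0 ∷ [])) (ℤₚ.+-identityʳ (α n)))

  -- The value depends on n only through α n. This gives the points above xbx and yby the same
  -- second coordinate.
  f-aba : ∀ n → n ≢ + 0 → f ((a₁ ^ᶻ n) · (b₁ · (a₁ ^ᶻ n))) ≡ α n ℤ.+ (β (+ 1) ℤ.+ α n)
  f-aba n n≢0 = begin
    f ((a₁ ^ᶻ n) · (b₁ · (a₁ ^ᶻ n)))
      ≡⟨ cong (λ g → f ((a₁ ^ᶻ n) · (b₁ · g))) (identityʳ (a₁ ^ᶻ n)) ⟨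
    f ⟦ (ga , n) ∷ (gb , + 1) ∷ (ga , n) ∷ [] ⟧
      ≡⟨ f-normal ((ga , n) ∷ (gb , + 1) ∷ (ga , n) ∷ []) ((λ ()) ∷ (λ ()) ∷ [-] , n≢0 ∷ (λ ()) ∷ n≢0 ∷ []) ⟩
    α n ℤ.+ (β (+ 1) ℤ.+ (α n ℤ.+ + 0))
      ≡⟨ cong (λ i → α n ℤ.+ (β (+ 1) ℤ.+ i)) (ℤₚ.+-identityʳ (α n)) ⟩
    α n ℤ.+ (β (+ 1) ℤ.+ α n) ∎
    where open ≡-Reasoning

  weight-odd : ∀ c i → weight (c , ℤ.- i) ≡ ℤ.- weight (c , i)
  weight-odd ga = α-odd
  weight-odd gb = β-odd

  total-ʳ++ : ∀ l r → total (l ʳ++ r) ≡ total l ℤ.+ total r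
  total-ʳ++ []      r = sym (ℤₚ.+-identityˡ (total r))
  total-ʳ++ (s ∷ l) r = trans (total-ʳ++ l (s ∷ r)) (rearrange (total l) (weight s) (total r))
    where
    rearrange : ∀ i j k → i ℤ.+ (j ℤ.+ k) ≡ (j ℤ.+ i) ℤ.+ k
    rearrange = solve-∀

  -- The left factor is kept in reverse, so that the syllables meeting in a product head two lists
  -- and `f-ʳ++` can recurse on both.
  reversed-normal-form : ∀ g → ∃[ l ] Normal l × ⟦ l ʳ++ [] ⟧ ≡ g × total l ≡ f g
  reversed-normal-form g with normal-form g
  ... | l , p , l≡g = l ʳ++ [] , Normal-reverse l p ,
    trans (cong ⟦_⟧ (trans (ʳ++-ʳ++ l) (++-identityʳ l))) l≡g ,
    trans (total-ʳ++ l []) (trans (ℤₚ.+-identityʳ (total l)) (trans (sym (f-normal l p)) (cong f l≡g)))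

  -- The quasimorphism bound

  module _ (A B : ℕ) (α-bounded : ∀ n → ∣ α n ∣ ℕ.≤ A) (β-bounded : ∀ n → ∣ β n ∣ ℕ.≤ B) where

    weight-bounded : ∀ s → ∣ weight s ∣ ℕ.≤ A ℕ.+ B
    weight-bounded (ga , i) = ℕₚ.≤-trans (α-bounded i) (ℕₚ.m≤m+n A B)
    weight-bounded (gb , i) = ℕₚ.≤-trans (β-bounded i) (ℕₚ.m≤n+m B A)

    -- When two syllables merge, one new weight replaces two old ones; each of the three is at most
    -- A + B.
    defect : ℕ
    defect = (A ℕ.+ B) ℕ.+ ((A ℕ.+ B) ℕ.+ (A ℕ.+ B))

    exact : ∀ {i j} → i ≡ j → ∣ i ℤ.- j ∣ ℕ.≤ defect
    exact {i} refl = subst (λ d → ∣ d ∣ ℕ.≤ defect) (sym (ℤₚ.+-inverseʳ i)) ℕ.z≤n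

    -- By oddness a pair of cancelling syllables contributes nothing, and at
    -- most one pair merges into a nontrivial syllable.
    f-ʳ++ : ∀ l r → Normal l → Normal r → ∣ f ⟦ l ʳ++ r ⟧ ℤ.- (total l ℤ.+ total r) ∣ ℕ.≤ defect
    f-ʳ++ [] r p q = exact (trans (f-normal r q) (sym (ℤₚ.+-identityˡ (total r))))
    f-ʳ++ l@(_ ∷ _) [] p q =
      exact (trans (f-normal (l ʳ++ []) (Normal-reverse l p)) (total-ʳ++ l []))
    f-ʳ++ l₀@((c , i) ∷ l) r₀@((d , j) ∷ r) p@(p₁ , i≢0 ∷ p₂) q@(q₁ , j≢0 ∷ q₂) with c ≟ᵍ d
    ... | no c≢d = exact (trans
            (f-normal (l₀ ʳ++ r₀) (Normal-ʳ++ l p (c≢d ∷ q₁ , i≢0 ∷ j≢0 ∷ q₂)))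
            (total-ʳ++ l₀ r₀))
    ... | yes refl with i ℤ.+ j ℤₚ.≟ + 0
    ...   | yes i+j≡0 = subst (λ e → ∣ e ∣ ℕ.≤ defect) difference
              (f-ʳ++ l r (Normal-tail p) (Normal-tail q))
      where
      j≡-i : j ≡ ℤ.- i
      j≡-i = GroupProperties.inverseʳ-unique ℤ-group i j i+j≡0
      cancel : ⟦ r ⟧ ≡ ⟦ (c , i) ∷ (c , j) ∷ r ⟧
      cancel = sym (trans (^ᶻ-merge (generator c) i j ⟦ r ⟧)
        (cong (λ e → (generator c ^ᶻ e) · ⟦ r ⟧) i+j≡0))
      regroup : ∀ w x y → x ℤ.+ y ≡ (w ℤ.+ x) ℤ.+ (ℤ.- w ℤ.+ y)
      regroup = solve-∀
      difference : f ⟦ l ʳ++ r ⟧ ℤ.- (total l ℤ.+ total r)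
                 ≡ f ⟦ l₀ ʳ++ r₀ ⟧ ℤ.- (total l₀ ℤ.+ total r₀)
      difference = cong₂ ℤ._-_ (cong f (⟦⟧-ʳ++-cong l cancel))
        (trans (regroup (weight (c , i)) (total l) (total r))
          (cong (λ w → total l₀ ℤ.+ (w ℤ.+ total r)) (sym (trans (cong (λ e → weight (c , e)) j≡-i) (weight-odd c i)))))
    ...   | no i+j≢0 = subst (λ e → ∣ e ∣ ℕ.≤ defect) (sym difference)
              (ℕₚ.≤-trans (ℤₚ.∣i-j∣≤∣i∣+∣j∣ (weight s) (weight (c , i) ℤ.+ weight (c , j)))
                (ℕₚ.+-mono-≤ (weight-bounded s)
                  (ℕₚ.≤-trans (ℤₚ.∣i+j∣≤∣i∣+∣j∣ (weight (c , i)) (weight (c , j)))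
                    (ℕₚ.+-mono-≤ (weight-bounded (c , i)) (weight-bounded (c , j))))))
      where
      s = c , i ℤ.+ j
      regroup : ∀ u v w x y → (x ℤ.+ (u ℤ.+ y)) ℤ.- ((v ℤ.+ x) ℤ.+ (w ℤ.+ y)) ≡ u ℤ.- (v ℤ.+ w)
      regroup = solve-∀
      difference : f ⟦ l₀ ʳ++ r₀ ⟧ ℤ.- (total l₀ ℤ.+ total r₀)
                 ≡ weight s ℤ.- (weight (c , i) ℤ.+ weight (c , j))
      difference = trans
        (cong (ℤ._- (total l₀ ℤ.+ total r₀)) (trans
          (cong f (⟦⟧-ʳ++-cong l {r′ = s ∷ r} (^ᶻ-merge (generator c) i j ⟦ r ⟧)))
          (trans (f-normal (l ʳ++ (s ∷ r)) (Normal-ʳ++ l (relabel p₁ , i+j≢0 ∷ p₂) (relabel q₁ , i+j≢0 ∷ q₂)))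
            (total-ʳ++ l (s ∷ r)))))
        (regroup (weight s) (weight (c , i)) (weight (c , j)) (total l) (total r))

    quasimorphism : ∀ g h → ∣ f (g · h) ℤ.- (f g ℤ.+ f h) ∣ ℕ.≤ defect
    quasimorphism g h with reversed-normal-form g | normal-form h
    ... | l , p , l≡g , l≡fg | r , q , r≡h = subst₂ (λ x y → ∣ f x ℤ.- y ∣ ℕ.≤ defect)
      (trans (⟦⟧-ʳ++ l r) (cong₂ _·_ l≡g r≡h))
      (cong₂ ℤ._+_ l≡fg (trans (sym (f-normal r q)) (cong f r≡h)))
      (f-ʳ++ l r p q)

  -- Powers of the quotient u

  cycles : ℕ → (p d : ℤ) → List Syllable
  cycles zero    p d = (gb , -[1+ 0 ]) ∷ (ga , d) ∷ (gb , + 1) ∷ (ga , p) ∷ []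
  cycles (suc k) p d = (gb , -[1+ 0 ]) ∷ (ga , d) ∷ (gb , + 1) ∷ (ga , d) ∷ cycles k p d

  -- This is the power with exponent k + 1; starting from u itself avoids the unit, for which the
  -- language has no symbol.
  positivePower : ℕ → F₂ → F₂
  positivePower zero    u = u
  positivePower (suc k) u = u · positivePower k u

  cycles-normal : ∀ k {n p d} → n ≢ + 0 → p ≢ + 0 → d ≢ + 0 → Normal ((ga , n) ∷ cycles k p d)
  cycles-normal zero    z p d = (λ ()) ∷ (λ ()) ∷ (λ ()) ∷ (λ ()) ∷ [-] , z ∷ (λ ()) ∷ d ∷ (λ ()) ∷ p ∷ []
  cycles-normal (suc k) z p d with cycles-normal k d p d
  ... | r , s = (λ ()) ∷ (λ ()) ∷ (λ ()) ∷ (λ ()) ∷ r , z ∷ (λ ()) ∷ d ∷ (λ ()) ∷ s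

  -- The normal form of u = (yby)⁻¹(xbx) for y = aⁿ and x = aᵖ, with d standing for p - n.
  -- Correspondingly, `cycles k` is what follows the first syllable in uᵏ⁺¹: at each junction aᵖa⁻ⁿ
  -- has become aᵈ.
  quotient : (n p d : ℤ) → F₂
  quotient n p d = ⟦ (ga , ℤ.- n) ∷ cycles 0 p d ⟧

  power-cycles : ∀ k n p d → n ℤ.+ d ≡ p →
    positivePower k (quotient n p d) ≡ ⟦ (ga , ℤ.- n) ∷ cycles k p d ⟧
  power-cycles zero    n p d n+d≡p = refl
  power-cycles (suc k) n p d n+d≡p = begin
    (A · (b⁻ · (D · (B · (P · 1F))))) · positivePower k (quotient n p d)
      ≡⟨ cong₂ (λ q r → (A · (b⁻ · (D · (B · q)))) · r) (identityʳ P) (power-cycles k n p d n+d≡p) ⟩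
    (A · (b⁻ · (D · (B · P)))) · (A · R)
      ≡⟨ assoc A (b⁻ · (D · (B · P))) (A · R) ⟩
    A · ((b⁻ · (D · (B · P))) · (A · R))
      ≡⟨ cong (A ·_) (assoc b⁻ (D · (B · P)) (A · R)) ⟩
    A · (b⁻ · ((D · (B · P)) · (A · R)))
      ≡⟨ cong (λ g → A · (b⁻ · g)) (assoc D (B · P) (A · R)) ⟩
    A · (b⁻ · (D · ((B · P) · (A · R))))
      ≡⟨ cong (λ g → A · (b⁻ · (D · g))) (assoc B P (A · R)) ⟩
    A · (b⁻ · (D · (B · (P · (A · R)))))
      ≡⟨ cong (λ g → A · (b⁻ · (D · (B · g)))) (trans (^ᶻ-merge a₁ p (ℤ.- n) R)
           (cong (λ i → (a₁ ^ᶻ i) · R) (trans (cong (ℤ._- n) (sym n+d≡p)) (cancel n d)))) ⟩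
    A · (b⁻ · (D · (B · (D · R)))) ∎
    where
    open ≡-Reasoning
    A = a₁ ^ᶻ (ℤ.- n)
    b⁻ = b₁ ^ᶻ -[1+ 0 ]
    B = b₁ ^ᶻ + 1
    D = a₁ ^ᶻ d
    P = a₁ ^ᶻ p
    R = ⟦ cycles k p d ⟧
    cancel : ∀ i j → (i ℤ.+ j) ℤ.- i ≡ j
    cancel = solve-∀

  -- There are k + 1 copies of aᵈ between b⁻¹ and b and k more at the junctions, while β(1) and
  -- β(-1) cancel by oddness.
  total-cycles : ∀ k p d → total (cycles k p d) ≡ + suc (k ℕ.+ k) ℤ.* α d ℤ.+ α p
  total-cycles zero    p d rewrite β-odd (+ 1) = regroup (β (+ 1)) (α d) (α p)
    where
    regroup : ∀ u v w → ℤ.- u ℤ.+ (v ℤ.+ (u ℤ.+ (w ℤ.+ + 0))) ≡ + 1 ℤ.* v ℤ.+ w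
    regroup = solve-∀
  total-cycles (suc k) p d rewrite β-odd (+ 1) | total-cycles k p d | ℕₚ.+-suc k k =
    regroup (β (+ 1)) (α d) (α p) (+ suc (k ℕ.+ k))
    where
    regroup : ∀ u v w i → ℤ.- u ℤ.+ (v ℤ.+ (u ℤ.+ (v ℤ.+ (i ℤ.* v ℤ.+ w)))) ≡ (+ 2 ℤ.+ i) ℤ.* v ℤ.+ w
    regroup = solve-∀

  ℤ-≢-neg : ∀ {i} → i ≢ + 0 → ℤ.- i ≢ + 0
  ℤ-≢-neg i≢0 -i≡0 = i≢0 (ℤₚ.neg-injective -i≡0)

  -- The outermost syllables contribute α(-n) + α(p) = 0, which leaves the copies of aᵈ alone.
  f-power : ∀ k n p d → n ≢ + 0 → p ≢ + 0 → d ≢ + 0 → n ℤ.+ d ≡ p → α p ≡ α n →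
    f (positivePower k (quotient n p d)) ≡ + suc (k ℕ.+ k) ℤ.* α d
  f-power k n p d n≢0 p≢0 d≢0 n+d≡p αp≡αn = begin
    f (positivePower k (quotient n p d))
      ≡⟨ cong f (power-cycles k n p d n+d≡p) ⟩
    f ⟦ (ga , ℤ.- n) ∷ cycles k p d ⟧
      ≡⟨ f-normal _ (cycles-normal k (ℤ-≢-neg n≢0) p≢0 d≢0) ⟩
    α (ℤ.- n) ℤ.+ total (cycles k p d)
      ≡⟨ cong₂ ℤ._+_ (α-odd n) (trans (total-cycles k p d) (cong (ℤ._+_ (+ suc (k ℕ.+ k) ℤ.* α d)) αp≡αn)) ⟩
    ℤ.- α n ℤ.+ (+ suc (k ℕ.+ k) ℤ.* α d ℤ.+ α n)
      ≡⟨ cancel (α n) (+ suc (k ℕ.+ k) ℤ.* α d) ⟩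
    + suc (k ℕ.+ k) ℤ.* α d ∎
    where
    open ≡-Reasoning
    cancel : ∀ i j → ℤ.- i ℤ.+ (j ℤ.+ i) ≡ j
    cancel = solve-∀

  f-power-large : ∀ k n p d → n ≢ + 0 → p ≢ + 0 → d ≢ + 0 → n ℤ.+ d ≡ p → α p ≡ α n → α d ≢ + 0 →
    k ℕ.< ∣ f (positivePower k (quotient n p d)) ∣
  f-power-large k n p d n≢0 p≢0 d≢0 n+d≡p αp≡αn αd≢0 = begin-strict
    k                              ≤⟨ ℕₚ.m≤m+n k k ⟩
    k ℕ.+ k                        <⟨ ℕₚ.≤-refl ⟩
    suc (k ℕ.+ k)                  ≤⟨ ℕₚ.m≤m*n (suc (k ℕ.+ k)) ∣ α d ∣ {{ℕ.≢-nonZero λ z → αd≢0 (ℤₚ.∣i∣≡0⇒i≡0 z)}} ⟩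
    suc (k ℕ.+ k) ℕ.* ∣ α d ∣      ≡⟨ ℤₚ.abs-* (+ suc (k ℕ.+ k)) (α d) ⟨
    ∣ + suc (k ℕ.+ k) ℤ.* α d ∣    ≡⟨ cong ∣_∣ (f-power k n p d n≢0 p≢0 d≢0 n+d≡p αp≡αn) ⟨
    ∣ f (positivePower k (quotient n p d)) ∣ ∎
    where open ℕₚ.≤-Reasoning

  -- Presenting u as the solution of an equation keeps inverses out of the formula that is
  -- transferred later.
  aba-quotient : ∀ n p d u → n ℤ.+ d ≡ p →
    ((a₁ ^ᶻ n) · (b₁ · (a₁ ^ᶻ n))) · u ≡ (a₁ ^ᶻ p) · (b₁ · (a₁ ^ᶻ p)) → u ≡ quotient n p d
  aba-quotient n p d u n+d≡p eq = ∙-cancelˡ t u (quotient n p d) (trans eq (sym (begin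
    (N · (b₁ · N)) · (N⁻ · (b⁻ · (D · (B · (P · 1F)))))
      ≡⟨ cong (λ q → (N · (b₁ · N)) · (N⁻ · (b⁻ · (D · (B · q))))) (identityʳ P) ⟩
    (N · (b₁ · N)) · (N⁻ · (b⁻ · (D · (B · P))))
      ≡⟨ trans (assoc N (b₁ · N) W) (cong (N ·_) (assoc b₁ N W)) ⟩
    N · (b₁ · (N · (N⁻ · (b⁻ · (D · (B · P))))))
      ≡⟨ cong (λ g → N · (b₁ · g)) (trans (^ᶻ-merge a₁ n (ℤ.- n) (b⁻ · (D · (B · P)))) (cong (λ i → (a₁ ^ᶻ i) · (b⁻ · (D · (B · P)))) (ℤₚ.+-inverseʳ n))) ⟩
    N · (b₁ · (b⁻ · (D · (B · P))))
      ≡⟨ cong (N ·_) (^ᶻ-merge b₁ (+ 1) -[1+ 0 ] (D · (B · P))) ⟩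
    N · (D · (B · P))
      ≡⟨ trans (^ᶻ-merge a₁ n d (B · P)) (cong (λ i → (a₁ ^ᶻ i) · (B · P)) n+d≡p) ⟩
    P · (B · P) ∎)))
    where
    open ≡-Reasoning
    N = a₁ ^ᶻ n
    N⁻ = a₁ ^ᶻ (ℤ.- n)
    b⁻ = b₁ ^ᶻ -[1+ 0 ]
    B = b₁ ^ᶻ + 1
    D = a₁ ^ᶻ d
    P = a₁ ^ᶻ p
    t = N · (b₁ · N)
    W = N⁻ · (b⁻ · (D · (B · P)))

  a-quotient : ∀ n p d → (a₁ ^ᶻ n) · d ≡ a₁ ^ᶻ p → d ≡ a₁ ^ᶻ (p ℤ.- n)
  a-quotient n p d eq = ∙-cancelˡ (a₁ ^ᶻ n) d (a₁ ^ᶻ (p ℤ.- n))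
    (trans eq (trans (cong (a₁ ^ᶻ_) (cancel n p)) (^ᶻ-+ a₁ n (p ℤ.- n))))
    where
    cancel : ∀ i j → j ≡ i ℤ.+ (j ℤ.- i)
    cancel = solve-∀

-- Sequences of exponents

∣i∣≡n⇒±n : ∀ i {n} → ∣ i ∣ ≡ n → i ≡ + n ⊎ i ≡ ℤ.- + n
∣i∣≡n⇒±n (+ n)    refl = inj₁ refl
∣i∣≡n⇒±n -[1+ n ] refl = inj₂ refl

module _ (em : ExcludedMiddle 0ℓ) where

  Frequent : (ℕ → ℤ) → ℤ → Set
  Frequent g v = ∀ N → ∃[ n ] N ℕ.≤ n × g n ≡ v

  frequent-or-avoided : ∀ g v → Frequent g v ⊎ ∃[ N ] ∀ n → N ℕ.≤ n → g n ≢ v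
  frequent-or-avoided g v with em {∃[ N ] ∀ n → N ℕ.≤ n → g n ≢ v}
  ... | yes avoided = inj₂ avoided
  ... | no ¬avoided = inj₁ λ N → decidable-stable em λ ¬hit →
          ¬avoided (N , λ n N≤n gn≡v → ¬hit (n , N≤n , gn≡v))

  -- Infinite pigeonhole: in passing from B to B + 1, only the values B and -B remain to be
  -- discarded.
  frequent-or-large : ∀ g B → (∃[ v ] Frequent g v) ⊎ ∃[ N ] ∀ n → N ℕ.≤ n → B ℕ.≤ ∣ g n ∣
  frequent-or-large g zero = inj₂ (0 , λ _ _ → ℕ.z≤n)
  frequent-or-large g (suc B)
    with frequent-or-large g B | frequent-or-avoided g (+ B) | frequent-or-avoided g (ℤ.- + B)
  ... | inj₁ found | _ | _ = inj₁ found
  ... | _ | inj₁ found | _ = inj₁ (_ , found)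
  ... | _ | _ | inj₁ found = inj₁ (_ , found)
  ... | inj₂ (N , large) | inj₂ (N₁ , ≢B) | inj₂ (N₂ , ≢-B) = inj₂ (N ℕ.⊔ (N₁ ℕ.⊔ N₂) , λ n le →
    ℕₚ.≤∧≢⇒< (large n (ℕₚ.m⊔n≤o⇒m≤o N _ le)) λ B≡ → [ ≢B n (ℕₚ.m⊔n≤o⇒m≤o N₁ N₂ (ℕₚ.m⊔n≤o⇒n≤o N _ le))
      , ≢-B n (ℕₚ.m⊔n≤o⇒n≤o N₁ N₂ (ℕₚ.m⊔n≤o⇒n≤o N _ le)) ]′ (∣i∣≡n⇒±n (g n) (sym B≡)))

  bounded⇒frequent : ∀ g B → (∀ n → ∣ g n ∣ ℕ.≤ B) → ∃[ v ] Frequent g v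
  bounded⇒frequent g B bound with frequent-or-large g (suc B)
  ... | inj₁ found       = found
  ... | inj₂ (N , large) = ⊥-elim (ℕₚ.n≮n B (ℕₚ.≤-trans (large N ℕₚ.≤-refl) (bound N)))

module Sparse (g : ℕ → ℤ) (v : ℤ) (frequent : ∀ N → ∃[ n ] N ℕ.≤ n × g n ≡ v) (R : ℕ) where

  -- The intervals of radius R around the entries are disjoint and avoid 0. If all zeros of α lie
  -- within R of 0, then α does not vanish on the sequence, and for fixed n at most one j has α(s j
  -- - n) = 0.
  s : ℕ → ℕ
  s zero    = proj₁ (frequent (suc R))
  s (suc j) = proj₁ (frequent (suc (s j ℕ.+ (R ℕ.+ R))))

  g-s : ∀ j → g (s j) ≡ v
  g-s zero    = proj₂ (proj₂ (frequent (suc R)))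
  g-s (suc j) = proj₂ (proj₂ (frequent (suc (s j ℕ.+ (R ℕ.+ R)))))

  step : ∀ j → s j ℕ.+ (R ℕ.+ R) ℕ.< s (suc j)
  step j = proj₁ (proj₂ (frequent (suc (s j ℕ.+ (R ℕ.+ R)))))

  R<s : ∀ j → R ℕ.< s j
  R<s zero    = proj₁ (proj₂ (frequent (suc R)))
  R<s (suc j) = ℕₚ.<-trans (R<s j) (ℕₚ.≤-<-trans (ℕₚ.m≤m+n (s j) (R ℕ.+ R)) (step j))

  gap : ∀ {j l} → j ℕ.<′ l → s j ℕ.+ (R ℕ.+ R) ℕ.< s l
  gap {j} ℕ.≤′-refl = step j
  gap {j} (ℕ.≤′-step {l} j<l) =
    ℕₚ.<-trans (gap j<l) (ℕₚ.≤-<-trans (ℕₚ.m≤m+n (s l) (R ℕ.+ R)) (step l))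

  far : ∀ n {j l} → j ℕ.< l → ∣ + s j ℤ.- n ∣ ℕ.≤ R → ∣ + s l ℤ.- n ∣ ℕ.≤ R → ⊥
  far n {j} {l} j<l p q = ℕₚ.<⇒≱ (gap (ℕₚ.<⇒<′ j<l)) (begin
    ∣ + s l ∣                                               ≡⟨ cong ∣_∣ (regroup (+ s j) (+ s l) n) ⟩
    ∣ + s j ℤ.+ ((+ s l ℤ.- n) ℤ.- (+ s j ℤ.- n)) ∣         ≤⟨ ℤₚ.∣i+j∣≤∣i∣+∣j∣ (+ s j) ((+ s l ℤ.- n) ℤ.- (+ s j ℤ.- n)) ⟩
    s j ℕ.+ ∣ (+ s l ℤ.- n) ℤ.- (+ s j ℤ.- n) ∣             ≤⟨ ℕₚ.+-monoʳ-≤ (s j) (ℤₚ.∣i-j∣≤∣i∣+∣j∣ (+ s l ℤ.- n) (+ s j ℤ.- n)) ⟩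
    s j ℕ.+ (∣ + s l ℤ.- n ∣ ℕ.+ ∣ + s j ℤ.- n ∣)           ≤⟨ ℕₚ.+-monoʳ-≤ (s j) (ℕₚ.+-mono-≤ q p) ⟩
    s j ℕ.+ (R ℕ.+ R)                                       ∎)
    where
    open ℕₚ.≤-Reasoning
    regroup : ∀ x y z → y ≡ x ℤ.+ ((y ℤ.- z) ℤ.- (x ℤ.- z))
    regroup = solve-∀

  not-both-close : ∀ n {j l} → j ≢ l → ∣ + s j ℤ.- n ∣ ℕ.≤ R → ∣ + s l ℤ.- n ∣ ℕ.≤ R → ⊥
  not-both-close n {j} {l} j≢l p q with ℕₚ.<-cmp j l
  ... | tri< j<l _ _ = far n j<l p q
  ... | tri≈ _ j≡l _ = j≢l j≡l
  ... | tri> _ _ l<j = far n l<j q p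

exceptions-bounded : ∀ {γ} → AlmostNonzero γ → ∃[ R ] ∀ n → R ℕ.< ∣ n ∣ → γ n ≢ + 0
exceptions-bounded (es , nonzero) = bound es , λ n large → nonzero n (outside es large)
  where
  bound : List ℤ → ℕ
  bound = foldr (λ e → ∣ e ∣ ℕ.⊔_) 0
  outside : ∀ es {n} → bound es ℕ.< ∣ n ∣ → n ∉ es
  outside (e ∷ es) lt (here refl) = ℕₚ.<⇒≱ lt (ℕₚ.m≤m⊔n ∣ e ∣ (bound es))
  outside (e ∷ es) lt (there n∈)  = outside es (ℕₚ.≤-<-trans (ℕₚ.m≤n⊔m ∣ e ∣ (bound es)) lt) n∈

-- Formulas

-- The symbols are parameters because the same abbreviations are also needed after new constants
-- have been added to the language.
module Formulas {ℓ} {L : Language Sort ℓ} (mul : Fun L (𝔽 ∷ 𝔽 ∷ []) 𝔽)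
                (add : Fun L (ℤs ∷ ℤs ∷ []) ℤs) (symf : Fun L (𝔽 ∷ []) ℤs) where

  infixr 9 _⊛_
  infixl 8 _⊞_

  _⊛_ : ∀ {Γ} → Term L Γ 𝔽 → Term L Γ 𝔽 → Term L Γ 𝔽
  t ⊛ u = app mul (t ∷ u ∷ [])

  _⊞_ : ∀ {Γ} → Term L Γ ℤs → Term L Γ ℤs → Term L Γ ℤs
  t ⊞ u = app add (t ∷ u ∷ [])

  F : ∀ {Γ} → Term L Γ 𝔽 → Term L Γ ℤs
  F t = app symf (t ∷ [])

  v₀ : ∀ {s Γ} → Term L (s ∷ Γ) s
  v₀ = var (here refl)

  v₁ : ∀ {p s Γ} → Term L (p ∷ s ∷ Γ) s
  v₁ = var (there (here refl))

  v₂ : ∀ {p q s Γ} → Term L (p ∷ q ∷ s ∷ Γ) s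
  v₂ = var (there (there (here refl)))

  v₃ : ∀ {p q r s Γ} → Term L (p ∷ q ∷ r ∷ s ∷ Γ) s
  v₃ = var (there (there (there (here refl))))

  v₄ : ∀ {o p q r s Γ} → Term L (o ∷ p ∷ q ∷ r ∷ s ∷ Γ) s
  v₄ = var (there (there (there (there (here refl)))))

  v₅ : ∀ {n o p q r s Γ} → Term L (n ∷ o ∷ p ∷ q ∷ r ∷ s ∷ Γ) s
  v₅ = var (there (there (there (there (there (here refl))))))

  v₆ : ∀ {m n o p q r s Γ} → Term L (m ∷ n ∷ o ∷ p ∷ q ∷ r ∷ s ∷ Γ) s
  v₆ = var (there (there (there (there (there (there (here refl)))))))

  v₇ : ∀ {l m n o p q r s Γ} → Term L (l ∷ m ∷ n ∷ o ∷ p ∷ q ∷ r ∷ s ∷ Γ) s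
  v₇ = var (there (there (there (there (there (there (there (here refl))))))))

  infix 5 ¬′_

  ¬′_ : ∀ {Γ} → Formula L Γ → Formula L Γ
  ¬′ φ = φ ⇒′ ⊥′

  Commute : ∀ {Γ} → Term L Γ 𝔽 → Term L Γ 𝔽 → Formula L Γ
  Commute t u = t ⊛ u ≐ u ⊛ t

  -- f t = 0, since the language has no symbol for 0
  Null : ∀ {Γ} → Term L Γ 𝔽 → Formula L Γ
  Null t = F t ⊞ F t ≐ F t

  -- ∣ s - t ∣ ≤ N if e is the integer 1
  near : ∀ {Γ} → ℕ → Term L Γ ℤs → Term L Γ ℤs → Term L Γ ℤs → Formula L Γ
  near zero    s t e = s ≐ t
  near (suc N) s t e = near N s t e ∨′ near N s (t ⊞ e) e ∨′ near N (s ⊞ e) t e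

  powerTerm : ∀ {Γ} → ℕ → Term L Γ 𝔽 → Term L Γ 𝔽
  powerTerm zero    t = t
  powerTerm (suc k) t = t ⊛ powerTerm k t

  module _ {c} (M : Structure L c) where

    Near : ℕ → Carrier M ℤs → Carrier M ℤs → Carrier M ℤs → Set c
    Near zero    x y e = x ≡ y
    Near (suc N) x y e = Near N x y e
      ⊎ Near N x (fun (interp M) add (y ∷ e ∷ [])) e
      ⊎ Near N (fun (interp M) add (x ∷ e ∷ [])) y e

    -- For a variable N the two sides do not unfold to the same type; an equality of types allows
    -- conversion with `subst id`.
    near≡Near : ∀ N {Γ} (ρ : Env M Γ) s t e →
      (M ⊨ near N s t e [ ρ ]) ≡ Near N (eval M ρ s) (eval M ρ t) (eval M ρ e)
    near≡Near zero    ρ s t e = refl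
    near≡Near (suc N) ρ s t e = cong₂ _⊎_ (near≡Near N ρ s t e)
      (cong₂ _⊎_ (near≡Near N ρ s (t ⊞ e) e) (near≡Near N ρ (s ⊞ e) t e))

    powerIn : ℕ → Carrier M 𝔽 → Carrier M 𝔽
    powerIn zero    g = g
    powerIn (suc k) g = fun (interp M) mul (g ∷ powerIn k g ∷ [])

    eval-powerTerm : ∀ k {Γ} (ρ : Env M Γ) t → eval M ρ (powerTerm k t) ≡ powerIn k (eval M ρ t)
    eval-powerTerm zero    ρ t = refl
    eval-powerTerm (suc k) ρ t = cong (λ g → fun (interp M) mul (eval M ρ t ∷ g ∷ [])) (eval-powerTerm k ρ t)

  -- The free variable is a, whose centralizer is a definable substitute for the set of powers of a.
  -- The two formulas translate between commuting with a and commuting with a parameter, because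
  -- `generic` names only the parameters.
  centralizer-abelian commuting-transitive : Formula L (𝔽 ∷ [])
  centralizer-abelian  = ∀′ ∀′ (Commute v₁ v₂ ⇒′ Commute v₀ v₂ ⇒′ Commute v₀ v₁)
  commuting-transitive = ∀′ ∀′ (Commute v₁ v₂ ⇒′ (¬′ Null v₁) ⇒′ Commute v₀ v₁ ⇒′ Commute v₀ v₂)

  F-determines-F-aba : Formula L (𝔽 ∷ 𝔽 ∷ [])
  F-determines-F-aba = ∀′ ∀′ (Commute v₁ v₂ ⇒′ Commute v₀ v₂ ⇒′ (¬′ Null v₁) ⇒′ (¬′ Null v₀) ⇒′
    F v₁ ≐ F v₀ ⇒′ F (v₁ ⊛ v₃ ⊛ v₁) ≐ F (v₀ ⊛ v₃ ⊛ v₀))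

  -- Here v₁ and v₀ are the quotients of two given elements by the same y; the point is that f
  -- cannot vanish on both.
  separated : Formula L (𝔽 ∷ 𝔽 ∷ 𝔽 ∷ [])
  separated = ∀′ ∀′ ∀′ (Commute v₂ v₃ ⇒′ v₂ ⊛ v₁ ≐ v₄ ⇒′ v₂ ⊛ v₀ ≐ v₅ ⇒′ Null v₁ ⇒′ ¬′ Null v₀)

  -- In a group the only idempotent is the unit, so this is the case of the empty product.
  near-identity : Formula L []
  near-identity = ∀′ ∀′ (v₁ ⊛ v₁ ≐ v₁ ⇒′ v₀ ⊞ v₀ ≐ v₀ ⇒′ F v₁ ≐ v₀)

  near-product : ℕ → ℕ → Formula L (ℤs ∷ [])
  near-product C N = ∀′ ∀′ ∀′ (near N (F v₁) v₀ v₃ ⇒′ near (C ℕ.+ N) (F (v₂ ⊛ v₁)) (F v₂ ⊞ v₀) v₃)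

  -- From the outside in, the bound variables are y, x, d = y⁻¹x, u = (yby)⁻¹(xbx) and the zero of
  -- the integers, each quotient being given by its defining equation. The free ones are a, b and 1.
  powers-far : ℕ → ℕ → Formula L (𝔽 ∷ 𝔽 ∷ ℤs ∷ [])
  powers-far k N = ∀′ ∀′ ∀′ ∀′ ∀′ (Commute v₄ v₅ ⇒′ Commute v₃ v₅ ⇒′ (¬′ Null v₄) ⇒′ (¬′ Null v₃) ⇒′
    F v₃ ≐ F v₄ ⇒′ v₄ ⊛ v₂ ≐ v₃ ⇒′ (¬′ Null v₂) ⇒′ (v₄ ⊛ v₆ ⊛ v₄) ⊛ v₁ ≐ v₃ ⊛ v₆ ⊛ v₃ ⇒′
    v₀ ⊞ v₀ ≐ v₀ ⇒′ ¬′ near N (F (powerTerm k v₁)) v₀ v₇)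

-- Transfer from the standard model

module StandardModel {ℓ} (α β : ℤ → ℤ) (f : F₂ → ℤ) (given : GivenBy α β f)
  (α-odd : Odd α) (β-odd : Odd β) (A B : ℕ)
  (α-bounded : ∀ n → ∣ α n ∣ ℕ.≤ A) (β-bounded : ∀ n → ∣ β n ∣ ℕ.≤ B)
  (L : Language Sort ℓ) (E : Interpretation L StdCarrier) where

  open Evaluation α β f given α-odd β-odd
  open Formulas {L = Base ⊕ L} (inj₁ mulS) (inj₁ addS) (inj₁ fS)

  M : Structure (Base ⊕ L) 0ℓ
  M = Std f E

  defectBound : ℕ
  defectBound = defect A B α-bounded β-bounded

  idempotent⇒0 : ∀ i → i ℤ.+ i ≡ i → i ≡ + 0
  idempotent⇒0 i = GroupProperties.identityˡ-unique ℤ-group i i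

  f≢0 : ∀ {g} → ¬ (f g ℤ.+ f g ≡ f g) → f g ≢ + 0
  f≢0 ¬null fg≡0 = ¬null (trans (cong₂ ℤ._+_ fg≡0 fg≡0) (sym fg≡0))

  f≢0⇒≢1 : ∀ {g} → f g ≢ + 0 → g ≢ 1F
  f≢0⇒≢1 fg≢0 refl = fg≢0 f-1

  f-aⁿ≢0⇒n≢0 : ∀ n → f (a₁ ^ᶻ n) ≢ + 0 → n ≢ + 0
  f-aⁿ≢0⇒n≢0 n ≢0 refl = ≢0 f-1

  distance-suc : ∀ {N} i j k → ∣ k ∣ ≡ 1 → ∣ i ℤ.- j ℤ.- k ∣ ℕ.≤ N → ∣ i ℤ.- j ∣ ℕ.≤ suc N
  distance-suc i j k ∣k∣≡1 le = subst (λ d → ∣ d ∣ ℕ.≤ _) (sym (regroup (i ℤ.- j) k))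
    (ℕₚ.≤-trans (ℤₚ.∣i+j∣≤∣i∣+∣j∣ k (i ℤ.- j ℤ.- k)) (ℕₚ.+-mono-≤ (ℕₚ.≤-reflexive ∣k∣≡1) le))
    where
    regroup : ∀ d k → d ≡ k ℤ.+ (d ℤ.- k)
    regroup = solve-∀

  Near⇒distance : ∀ N {i j} → Near M N i j (+ 1) → ∣ i ℤ.- j ∣ ℕ.≤ N
  Near⇒distance zero {i} refl = ℕₚ.≤-reflexive (cong ∣_∣ (ℤₚ.+-inverseʳ i))
  Near⇒distance (suc N) (inj₁ p) = ℕₚ.m≤n⇒m≤1+n (Near⇒distance N p)
  Near⇒distance (suc N) {i} {j} (inj₂ (inj₁ p)) = distance-suc i j (+ 1) refl
    (subst (λ d → ∣ d ∣ ℕ.≤ N) (regroup i j) (Near⇒distance N p))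
    where
    regroup : ∀ i j → i ℤ.- (j ℤ.+ + 1) ≡ i ℤ.- j ℤ.- + 1
    regroup = solve-∀
  Near⇒distance (suc N) {i} {j} (inj₂ (inj₂ p)) = distance-suc i j (ℤ.- + 1) refl
    (subst (λ d → ∣ d ∣ ℕ.≤ N) (regroup i j) (Near⇒distance N p))
    where
    regroup : ∀ i j → (i ℤ.+ + 1) ℤ.- j ≡ i ℤ.- j ℤ.- (ℤ.- + 1)
    regroup = solve-∀

  distance⇒Near : ∀ N {i j} → ∣ i ℤ.- j ∣ ℕ.≤ N → Near M N i j (+ 1)
  distance⇒Near zero {i} {j} le = ℤₚ.i-j≡0⇒i≡j i j (ℤₚ.∣i∣≡0⇒i≡0 (ℕₚ.n≤0⇒n≡0 le))
  distance⇒Near (suc N) {i} {j} le with ∣ i ℤ.- j ∣ ℕₚ.≤? N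
  ... | yes le′ = inj₁ (distance⇒Near N le′)
  -- At distance exactly N + 1 the smaller of the two integers is moved up by 1.
  ... | no ≰N with ∣i∣≡n⇒±n (i ℤ.- j) (ℕₚ.≤-antisym le (ℕₚ.≰⇒> ≰N))
  ...   | inj₁ p = inj₂ (inj₁ (distance⇒Near N (ℕₚ.≤-reflexive (cong ∣_∣
            (trans (regroup i j) (cong (ℤ._- + 1) p))))))
    where
    regroup : ∀ i j → i ℤ.- (j ℤ.+ + 1) ≡ i ℤ.- j ℤ.- + 1
    regroup = solve-∀
  ...   | inj₂ p = inj₂ (inj₂ (distance⇒Near N (ℕₚ.≤-reflexive (trans (cong ∣_∣
            (trans (regroup i j) (trans (cong (ℤ._+ + 1) p) (neg-suc (+ N))))) (ℤₚ.∣-i∣≡∣i∣ (+ N))))))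
    where
    regroup : ∀ i j → (i ℤ.+ + 1) ℤ.- j ≡ i ℤ.- j ℤ.+ + 1
    regroup = solve-∀
    neg-suc : ∀ i → ℤ.- (+ 1 ℤ.+ i) ℤ.+ + 1 ≡ ℤ.- i
    neg-suc = solve-∀

  ⊨centralizer-abelian : M ⊨ centralizer-abelian [ a₁ ∷ [] ]
  ⊨centralizer-abelian y x ya≡ay xa≡ax with commutes-a⇒power y ya≡ay | commutes-a⇒power x xa≡ax
  ... | n , refl | p , refl = ^ᶻ-comm a₁ p n

  ⊨commuting-transitive : M ⊨ commuting-transitive [ a₁ ∷ [] ]
  ⊨commuting-transitive y x ya≡ay ¬null xy≡yx
    with commutes-trans x y ya≡ay (f≢0⇒≢1 (f≢0 (λ z → lower (¬null z)))) xy≡yx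
  ... | n , refl = a-commutes n

  ⊨F-determines-F-aba : M ⊨ F-determines-F-aba [ a₁ ∷ b₁ ∷ [] ]
  ⊨F-determines-F-aba y x ya≡ay xa≡ax ¬null-y ¬null-x fy≡fx
    with commutes-a⇒power y ya≡ay | commutes-a⇒power x xa≡ax
  ... | n , refl | p , refl = trans
    (f-aba n (f-aⁿ≢0⇒n≢0 n (f≢0 (λ z → lower (¬null-y z)))))
    (trans (cong₂ (λ i j → i ℤ.+ (β (+ 1) ℤ.+ j)) αn≡αp αn≡αp)
      (sym (f-aba p (f-aⁿ≢0⇒n≢0 p (f≢0 (λ z → lower (¬null-x z)))))))
    where
    αn≡αp : α n ≡ α p
    αn≡αp = trans (sym (f-a n)) (trans fy≡fx (f-a p))

  ⊨separated : ∀ s t → (∀ n → α (s ℤ.- n) ≡ + 0 → α (t ℤ.- n) ≡ + 0 → ⊥) →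
    M ⊨ separated [ a₁ ∷ (a₁ ^ᶻ s) ∷ (a₁ ^ᶻ t) ∷ [] ]
  ⊨separated s t never y d d′ ya≡ay yd≡ yd′≡ null-d null-d′ with commutes-a⇒power y ya≡ay
  ... | n , refl = lift (never n (vanish s d yd≡ null-d) (vanish t d′ yd′≡ null-d′))
    where
    vanish : ∀ s d → (a₁ ^ᶻ n) · d ≡ a₁ ^ᶻ s → f d ℤ.+ f d ≡ f d → α (s ℤ.- n) ≡ + 0
    vanish s d eq null = trans (sym (f-a (s ℤ.- n)))
      (trans (cong f (sym (a-quotient n s d eq))) (idempotent⇒0 (f d) null))

  ⊨near-identity : M ⊨ near-identity [ [] ]
  ⊨near-identity g z gg≡g zz≡z = trans
    (trans (cong f (GroupProperties.identityˡ-unique F₂-group g g gg≡g)) f-1)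
    (sym (idempotent⇒0 z zz≡z))

  ⊨near-product : ∀ N → M ⊨ near-product defectBound N [ + 1 ∷ [] ]
  ⊨near-product N g h z close =
    subst id (sym (near≡Near M (defectBound ℕ.+ N) ρ (F (v₂ ⊛ v₁)) (F v₂ ⊞ v₀) v₃))
      (distance⇒Near (defectBound ℕ.+ N) (subst (λ d → ∣ d ∣ ℕ.≤ _) (regroup (f (g · h)) (f g) (f h) z)
        (ℕₚ.≤-trans (ℤₚ.∣i+j∣≤∣i∣+∣j∣ (f (g · h) ℤ.- (f g ℤ.+ f h)) (f h ℤ.- z))
          (ℕₚ.+-mono-≤ (quasimorphism A B α-bounded β-bounded g h)
            (Near⇒distance N (subst id (near≡Near M N ρ (F v₁) v₀ v₃) close))))))
    where
    ρ : Env M (ℤs ∷ 𝔽 ∷ 𝔽 ∷ ℤs ∷ [])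
    ρ = z ∷ h ∷ g ∷ + 1 ∷ []
    regroup : ∀ i j k l → (i ℤ.- (j ℤ.+ k)) ℤ.+ (k ℤ.- l) ≡ i ℤ.- (j ℤ.+ l)
    regroup = solve-∀

  powerIn≡positivePower : ∀ k u → powerIn M k u ≡ positivePower k u
  powerIn≡positivePower zero    u = refl
  powerIn≡positivePower (suc k) u = cong (u ·_) (powerIn≡positivePower k u)

  -- One N serves as index and radius: the power of u has exponent N + 1, and the absolute value of
  -- f there is at least 2N + 1.
  ⊨powers-far : ∀ N → M ⊨ powers-far N N [ a₁ ∷ b₁ ∷ + 1 ∷ [] ]
  ⊨powers-far N y x d u z ya≡ay xa≡ax ¬null-y ¬null-x fx≡fy yd≡x ¬null-d tu≡t′ zz≡z close
    with commutes-a⇒power y ya≡ay | commutes-a⇒power x xa≡ax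
  ... | n , refl | p , refl = lift (ℕₚ.<⇒≱
    (f-power-large N n p q
      (f-aⁿ≢0⇒n≢0 n (f≢0 (λ e → lower (¬null-y e)))) (f-aⁿ≢0⇒n≢0 p (f≢0 (λ e → lower (¬null-x e))))
      (f-aⁿ≢0⇒n≢0 q fq≢0) n+q≡p (trans (sym (f-a p)) (trans fx≡fy (f-a n)))
      (λ αq≡0 → fq≢0 (trans (f-a q) αq≡0)))
    (subst (λ i → ∣ i ∣ ℕ.≤ N) (trans (cong₂ (λ g w → f g ℤ.- w) uᵏ≡ (idempotent⇒0 z zz≡z)) (ℤₚ.+-identityʳ (f (positivePower N (quotient n p q)))))
      (Near⇒distance N (subst id (near≡Near M N ρ (F (powerTerm N v₁)) v₀ v₇) close))))
    where
    q = p ℤ.- n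
    ρ : Env M (ℤs ∷ 𝔽 ∷ 𝔽 ∷ 𝔽 ∷ 𝔽 ∷ 𝔽 ∷ 𝔽 ∷ ℤs ∷ [])
    ρ = z ∷ u ∷ d ∷ (a₁ ^ᶻ p) ∷ (a₁ ^ᶻ n) ∷ a₁ ∷ b₁ ∷ + 1 ∷ []
    n+q≡p : n ℤ.+ q ≡ p
    n+q≡p = cancel n p
      where
      cancel : ∀ i j → i ℤ.+ (j ℤ.- i) ≡ j
      cancel = solve-∀
    fq≢0 : f (a₁ ^ᶻ q) ≢ + 0
    fq≢0 = subst (λ g → f g ≢ + 0) (a-quotient n p d yd≡x) (f≢0 (λ e → lower (¬null-d e)))
    uᵏ≡ : eval M ρ (powerTerm N v₁) ≡ positivePower N (quotient n p q)
    uᵏ≡ = trans (eval-powerTerm M N ρ v₁) (trans (powerIn≡positivePower N u)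
      (cong (positivePower N) (aba-quotient n p q u n+q≡p tu≡t′)))

-- Axial elements and powers of X in M*

module Extension {ℓ} (em : ExcludedMiddle ℓ) (α β : ℤ → ℤ) (f : F₂ → ℤ) (given : GivenBy α β f)
  (α-odd : Odd α) (β-odd : Odd β) (A B : ℕ)
  (α-bounded : ∀ n → ∣ α n ∣ ℕ.≤ A) (β-bounded : ∀ n → ∣ β n ∣ ℕ.≤ B) (α-nonzero : AlmostNonzero α)
  (L : Language Sort ℓ) (E : Interpretation L StdCarrier)
  (M* : Structure (Base ⊕ L) ℓ) (ext : Std f E ≼ M*) where

  open Evaluation α β f given α-odd β-odd
  open StandardModel α β f given α-odd β-odd A B α-bounded β-bounded L E
  open Formulas {L = Base ⊕ L} (inj₁ mulS) (inj₁ addS) (inj₁ fS)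

  private
    module 𝔽* = Group (F₂* M* ext)
    module ℤ* = Group (ℤ* M* ext)
    module G* = Group (F₂*×ℤ* M* ext)
    module 𝔽*ₚ = GroupProperties (F₂* M* ext)
    module G*ₚ = GroupProperties (F₂*×ℤ* M* ext)

  𝔾 : Set ℓ
  𝔾 = Carrier M* 𝔽

  F* : 𝔾 → Carrier M* ℤs
  F* = f* M* ext

  Null* : 𝔾 → Set ℓ
  Null* g = F* g ℤ*.∙ F* g ≡ F* g

  transfer : ∀ {Γ} (φ : Formula (Base ⊕ L) Γ) (ρ : Env M Γ) → M ⊨ φ [ ρ ] → M* ⊨ φ [ All.map (embed ext) ρ ]
  transfer φ ρ = Equivalence.to (elementary ext φ ρ)

  em₀ : ExcludedMiddle 0ℓ
  em₀ {P} = map′ lower lift (em {Lift ℓ P})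

  R : ℕ
  R = proj₁ (exceptions-bounded α-nonzero)

  α-large : ∀ n → R ℕ.< ∣ n ∣ → α n ≢ + 0
  α-large = proj₂ (exceptions-bounded α-nonzero)

  private
    frequentValue : ∃[ v ] Frequent em₀ (λ n → α (+ n)) v
    frequentValue = bounded⇒frequent em₀ (λ n → α (+ n)) A (λ n → α-bounded (+ n))

  open Sparse (λ n → α (+ n)) (proj₁ frequentValue) (proj₂ frequentValue) R

  a* b* : 𝔾
  a* = embed ext a₁
  b* = embed ext b₁

  e* : Carrier M* ℤs
  e* = embed ext (+ 1)

  t : ℕ → 𝔾
  t j = embed ext (a₁ ^ᶻ + s j)

  -- the definable set {aⁿ : α(n) = v}, on which v ≠ 0
  record Axial (g : 𝔾) : Set ℓ where
    constructor axial
    field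
      commutes : g 𝔽*.∙ a* ≡ a* 𝔽*.∙ g
      nonnull  : ¬ Null* g
      value    : F* g ≡ F* (t 0)
  open Axial

  t-axial : ∀ j → Axial (t j)
  t-axial j = axial
    (transfer (Commute v₀ v₁) ((a₁ ^ᶻ + s j) ∷ a₁ ∷ []) (a-commutes (+ s j)))
    (λ null → lower (transfer (¬′ Null v₀) ((a₁ ^ᶻ + s j) ∷ [])
      (λ e → lift (α-large (+ s j) (R<s j) (trans (sym (f-a (+ s j))) (idempotent⇒0 _ e)))) null))
    (transfer (F v₀ ≐ F v₁) ((a₁ ^ᶻ + s j) ∷ (a₁ ^ᶻ + s 0) ∷ [])
      (trans (f-a (+ s j)) (trans (trans (g-s j) (sym (g-s 0))) (sym (f-a (+ s 0))))))

  -- In M, a null quotient aⁿ⁻ʸ-type argument reduces to two zeros of α at `s j` - n and `s l` - n,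
  -- which the spacing excludes. Transfer extends this to every y in the centralizer of a in M*.
  t-separated : ∀ {j l} → j ≢ l → ∀ y d d′ → y 𝔽*.∙ a* ≡ a* 𝔽*.∙ y →
    y 𝔽*.∙ d ≡ t j → y 𝔽*.∙ d′ ≡ t l → Null* d → ¬ Null* d′
  t-separated {j} {l} j≢l y d d′ ya≡ay yd≡ yd′≡ null null′ = lower
    (transfer separated (a₁ ∷ (a₁ ^ᶻ + s j) ∷ (a₁ ^ᶻ + s l) ∷ [])
      (⊨separated (+ s j) (+ s l) (λ n p q → not-both-close n j≢l (close p) (close q)))
      y d d′ ya≡ay yd≡ yd′≡ null null′)
    where
    close : ∀ {i} → α i ≡ + 0 → ∣ i ∣ ℕ.≤ R
    close {i} p = ℕₚ.≮⇒≥ λ R<i → α-large i R<i p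

  Near* : ℕ → Carrier M* ℤs → Carrier M* ℤs → Set ℓ
  Near* N x y = Near M* N x y e*

  near-∙ : ∀ N g h z → Near* N (F* h) z → Near* (defectBound ℕ.+ N) (F* (g 𝔽*.∙ h)) (F* g ℤ*.∙ z)
  near-∙ N g h z close =
    subst id (near≡Near M* (defectBound ℕ.+ N) ρ (F (v₂ ⊛ v₁)) (F v₂ ⊞ v₀) v₃)
      (transfer (near-product defectBound N) (+ 1 ∷ []) (⊨near-product N) g h z
        (subst id (sym (near≡Near M* N ρ (F v₁) v₀ v₃)) close))
    where
    ρ : Env M* (ℤs ∷ 𝔽 ∷ 𝔽 ∷ ℤs ∷ [])
    ρ = z ∷ h ∷ g ∷ e* ∷ []

  -- Every factor costs one defect, including the first, which is multiplied by the unit.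
  power⇒near : ∀ m {g z} → Power (F₂*×ℤ* M* ext) (X M* ext) m (g , z) → Near* (m ℕ.* defectBound) (F* g) z
  power⇒near zero (lift (refl , refl)) =
    transfer near-identity [] ⊨near-identity 𝔽*.ε ℤ*.ε (𝔽*.identityˡ 𝔽*.ε) (ℤ*.identityˡ ℤ*.ε)
  power⇒near (suc m) ((g , _) , (h , z) , refl , Xᵐ , refl , refl) =
    near-∙ (m ℕ.* defectBound) g h z (power⇒near m Xᵐ)

  aba : 𝔾 → 𝔾
  aba g = g 𝔽*.∙ (b* 𝔽*.∙ g)

  F-aba : ∀ {g h} → Axial g → Axial h → F* (aba g) ≡ F* (aba h)
  F-aba {g} {h} p q = transfer F-determines-F-aba (a₁ ∷ b₁ ∷ []) ⊨F-determines-F-aba g h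
    (commutes p) (commutes q) (λ e → lift (nonnull p e)) (λ e → lift (nonnull q e))
    (trans (value p) (sym (value q)))

  power-not-near : ∀ N {y x d u} → Axial y → Axial x → y 𝔽*.∙ d ≡ x → ¬ Null* d →
    aba y 𝔽*.∙ u ≡ aba x → ¬ Near* N (F* (powerIn M* N u)) ℤ*.ε
  power-not-near N {y} {x} {d} {u} p q yd≡x ¬null-d tu≡t′ close = lower
    (transfer (powers-far N N) (a₁ ∷ b₁ ∷ + 1 ∷ []) (⊨powers-far N) y x d u ℤ*.ε
      (commutes p) (commutes q) (λ e → lift (nonnull p e)) (λ e → lift (nonnull q e))
      (trans (value q) (sym (value p))) yd≡x (λ e → lift (¬null-d e)) tu≡t′ (ℤ*.identityˡ ℤ*.ε)
      (subst id (sym (near≡Near M* N ρ (F (powerTerm N v₁)) v₀ v₇))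
        (subst (λ g → Near* N (F* g) ℤ*.ε) (sym (eval-powerTerm M* N ρ v₁)) close)))
    where
    ρ : Env M* (ℤs ∷ 𝔽 ∷ 𝔽 ∷ 𝔽 ∷ 𝔽 ∷ 𝔽 ∷ 𝔽 ∷ ℤs ∷ [])
    ρ = ℤ*.ε ∷ u ∷ d ∷ x ∷ y ∷ a* ∷ b* ∷ e* ∷ []

  -- Elements generic over a family of parameters

  module _ {I : Set ℓ} (c : I → 𝔾) (c-axial : ∀ i → Axial (c i)) where

    private
      L⁺ : Language Sort ℓ
      L⁺ = (Base ⊕ L) ⊕ Constants {I = I} (λ _ → 𝔽)

      M⁺ : Structure L⁺ ℓ
      M⁺ = M* ⟪ c ⟫

      module F⁺ = Formulas {L = L⁺} (inj₁ (inj₁ mulS)) (inj₁ (inj₁ addS)) (inj₁ (inj₁ fS))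

      constant : ∀ {Γ} → I → Term L⁺ Γ 𝔽
      constant i = app (inj₂ (const i)) []

    -- Since a is not a named constant, membership in the set of axial elements is expressed through
    -- `c i`. The last conjunct says that f does not vanish on the quotient by `c i`.
    generic : I → Formula L⁺ (𝔽 ∷ [])
    generic i = F⁺.Commute F⁺.v₀ (constant i)
      ∧′ F⁺.F F⁺.v₀ ≐ F⁺.F (constant i)
      ∧′ (F⁺.¬′ F⁺.Null F⁺.v₀)
      ∧′ (∀′ (constant i F⁺.⊛ F⁺.v₀ ≐ F⁺.v₁ ⇒′ F⁺.¬′ F⁺.Null F⁺.v₀))

    type : Pred (Formula L⁺ (𝔽 ∷ [])) ℓ
    type φ = ∃[ i ] φ ≡ generic i

    t-generic : ∀ i j → (∀ d → c i 𝔽*.∙ d ≡ t j → ¬ Null* d) → M⁺ ⊨ generic i [ t j ∷ [] ]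
    t-generic i j free =
      transfer centralizer-abelian (a₁ ∷ []) ⊨centralizer-abelian (c i) (t j)
        (commutes (c-axial i)) (commutes (t-axial j)) ,
      trans (value (t-axial j)) (sym (value (c-axial i))) ,
      (λ e → lift (nonnull (t-axial j) e)) ,
      λ d eq e → lift (free d eq e)

    at-most-one-nongeneric : ∀ i {j l} → j ≢ l → ¬ (M⁺ ⊨ generic i [ t j ∷ [] ]) → M⁺ ⊨ generic i [ t l ∷ [] ]
    at-most-one-nongeneric i {j} {l} j≢l ¬generic = t-generic i l λ d′ eq′ null′ →
      ¬generic (t-generic i j λ d eq null →
        t-separated j≢l (c i) d d′ (commutes (c-axial i)) eq eq′ null null′)

    -- Each formula of the list fails at no more than one `t j`, so it suffices to go past the
    -- finitely many failures.
    eventually-generic : ∀ φs → All type φs →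
      ∃[ N ] ∀ j → N ℕ.≤ j → All (λ φ → M⁺ ⊨ φ [ t j ∷ [] ]) φs
    eventually-generic [] [] = 0 , λ _ _ → []
    eventually-generic (_ ∷ φs) ((i , refl) ∷ ps)
      with eventually-generic φs ps | em {Lift ℓ (∃[ j ] ¬ (M⁺ ⊨ generic i [ t j ∷ [] ]))}
    ... | N , good | no none = N , λ j N≤j →
            decidable-stable em (λ bad → none (lift (j , bad))) ∷ good j N≤j
    ... | N , good | yes (lift (k , bad)) = suc k ℕ.⊔ N , λ j le →
            at-most-one-nongeneric i (ℕₚ.<⇒≢ (ℕₚ.m⊔n≤o⇒m≤o (suc k) N le)) bad ∷ good j (ℕₚ.m⊔n≤o⇒n≤o (suc k) N le)

    finitely-satisfiable : ∀ φs → All type φs → ∃[ ρ ] All (λ φ → M⁺ ⊨ φ [ ρ ]) φs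
    finitely-satisfiable φs ps with eventually-generic φs ps
    ... | N , good = t N ∷ [] , good N ℕₚ.≤-refl

    generic-axial : ∀ i {x} → M⁺ ⊨ generic i [ x ∷ [] ] → Axial x
    generic-axial i {x} (xc≡cx , fx≡fc , ¬null , _) = axial
      (transfer commuting-transitive (a₁ ∷ []) ⊨commuting-transitive (c i) x
        (commutes (c-axial i)) (λ e → lift (nonnull (c-axial i) e)) xc≡cx)
      (λ e → lower (¬null e))
      (trans fx≡fc (value (c-axial i)))

  -- Two points in one coset of K

  module _ {κ : Set ℓ} (monster : Monster κ M*) {K : Pred G*.Carrier ℓ}
           (hK : InvariantBounded M* ext κ K) where

    open InvariantBounded hK
    open IsSubgroup subgroup using (∙-closed; ⁻¹-closed) renaming (resp to K-resp)

    private
      I = proj₁ bounded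
      I≺κ = proj₁ (proj₂ bounded)
      r = proj₁ (proj₂ (proj₂ bounded))
      cover = proj₂ (proj₂ (proj₂ (proj₂ bounded)))

    point : 𝔾 → G*.Carrier
    point g = aba g , F* (aba g)

    InCoset : I → 𝔾 → Set ℓ
    InCoset i g = K (r i G*.⁻¹ G*.∙ point g)

    -- The y are chosen before x. A coset without a suitable point gets `t 0` as a default, so that
    -- every parameter is axial.
    representative : ∀ i → ∃[ y ] Axial y × (∀ x → Axial x → InCoset i x → InCoset i y)
    representative i with em {∃[ y ] Axial y × InCoset i y}
    ... | yes (y , p , q) = y , p , λ _ _ _ → q
    ... | no none = t 0 , t-axial 0 , λ x p q → ⊥-elim (none (x , p , q))

    same-coset : ∀ g {x y} → K (g G*.⁻¹ G*.∙ x) → K (g G*.⁻¹ G*.∙ y) → K (x G*.⁻¹ G*.∙ y)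
    same-coset g {x} {y} p q = K-resp (begin
      (g G*.⁻¹ G*.∙ x) G*.⁻¹ G*.∙ (g G*.⁻¹ G*.∙ y)
        ≈⟨ G*.∙-congʳ (G*ₚ.⁻¹-anti-homo-∙ (g G*.⁻¹) x) ⟩
      (x G*.⁻¹ G*.∙ (g G*.⁻¹) G*.⁻¹) G*.∙ (g G*.⁻¹ G*.∙ y)
        ≈⟨ G*.assoc (x G*.⁻¹) ((g G*.⁻¹) G*.⁻¹) (g G*.⁻¹ G*.∙ y) ⟩
      x G*.⁻¹ G*.∙ ((g G*.⁻¹) G*.⁻¹ G*.∙ (g G*.⁻¹ G*.∙ y))
        ≈⟨ G*.∙-congˡ {x G*.⁻¹} (G*ₚ.\\-leftDividesʳ (g G*.⁻¹) y) ⟩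
      x G*.⁻¹ G*.∙ y ∎) (∙-closed (⁻¹-closed p) q)
      where
      open SetoidReasoning G*.setoid

    powers-closed : ∀ k {u} → K (u , ℤ*.ε) → K (powerIn M* k u , ℤ*.ε)
    powers-closed zero    p = p
    powers-closed (suc k) p = K-resp (refl , ℤ*.identityˡ ℤ*.ε) (∙-closed p (powers-closed k p))

    centre : I → 𝔾
    centre i = proj₁ (representative i)

    centre-axial : ∀ i → Axial (centre i)
    centre-axial i = proj₁ (proj₂ (representative i))

    -- Fewer than κ cosets means fewer than κ parameters, so one x is generic over all of them at
    -- once. Whichever coset its point falls into, the parameter of that coset can serve as y.
    generic-point : ∃[ x ] ∀ i → (M* ⟪ centre ⟫) ⊨ generic centre centre-axial i [ x ∷ [] ]
    generic-point with Monster.saturated monster I I≺κ (λ _ → 𝔽) centre (𝔽 ∷ [])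
                         (type centre centre-axial) (finitely-satisfiable centre centre-axial)
    ... | x ∷ [] , realizes = x , λ i → realizes (generic centre centre-axial i) (i , refl)

    not-inside-power : ∀ m → ¬ (K ⊆ Power (F₂*×ℤ* M* ext) (X M* ext) m)
    not-inside-power m K⊆Xᵐ = power-not-near N (centre-axial i) x-axial (𝔽*ₚ.\\-leftDividesˡ y x)
      (λ null → lower (proj₂ (proj₂ (proj₂ (x-generic i))) (y 𝔽*.⁻¹ 𝔽*.∙ x) (𝔽*ₚ.\\-leftDividesˡ y x) null))
      (𝔽*ₚ.\\-leftDividesˡ (aba y) (aba x))
      (power⇒near m (K⊆Xᵐ (powers-closed N u∈K)))
      where
      N = m ℕ.* defectBound
      x = proj₁ generic-point
      x-generic = proj₂ generic-point
      i = proj₁ (cover (point x) (gen refl))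
      y = centre i
      x-axial = generic-axial centre centre-axial i (x-generic i)
      x∈ : InCoset i x
      x∈ = proj₂ (cover (point x) (gen refl))
      u∈K : K (aba y 𝔽*.⁻¹ 𝔽*.∙ aba x , ℤ*.ε)
      -- By `F-aba` the two points agree in the second coordinate, so their quotient has 0 there.
      u∈K = K-resp (refl , trans (cong (λ z → z ℤ*.⁻¹ ℤ*.∙ F* (aba x)) (F-aba (centre-axial i) x-axial))
        (ℤ*.inverseˡ (F* (aba x))))
        (same-coset (r i) (proj₂ (proj₂ (representative i)) x x-axial x∈) x∈)

proposition5p10 : ∀ {ℓ} → ExcludedMiddle ℓ →
    ∀ (α β : ℤ → ℤ) → Bounded α → Odd α → Bounded β → Odd β → AlmostNonzero α →
    ∀ (f : F₂ → ℤ) → GivenBy α β f →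
    ∀ (L : Language Sort ℓ) (E : Interpretation L StdCarrier) →
    ∀ (κ : Set ℓ) (M* : Structure (Base ⊕ L) ℓ) (ext : Std f E ≼ M*) → Monster κ M* →
    ∀ (K : Pred (Group.Carrier (F₂*×ℤ* M* ext)) ℓ) → IsH⁰⁰⁰ M* ext κ K →
    ∀ m → m ≥ 1 → K ⊈ Power (F₂*×ℤ* M* ext) (X M* ext) m
proposition5p10 em α β (A , α-bounded) α-odd (B , β-bounded) β-odd α-nonzero f given L E κ M* ext monster K isH m _ =
  not-inside-power monster (IsH⁰⁰⁰.invariantBounded isH) m
  where
  open Extension em α β f given α-odd β-odd A B α-bounded β-bounded α-nonzero L E M* ext
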